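{- For every fixed constant $k\ge 1$, there is a polynomial-time $2$-approximation algorithm for $k$-tier FMGC: given a feasible instance, it returns a feasible solution whose cost is at most twice the minimum cost of a feasible solution.
   Context: $k$-tier Flexible Multigraph Connectivity ($k$-tier FMGC). Input: an undirected graph $G=(V,E)$ with edge costs $c:E\to\mathbb{R}_{\ge0}$, a nested family of edge-tiers $T_1\subseteq T_2\subseteq\cdots\subseteq T_k=E$, and integers $0\le q_1\le q_2\le\cdots\le q_k$. A feasible solution is a vector $x\in\mathbb{Z}_{\ge0}^E$ such that for every $\emptyset\ne R\subsetneq V$ there exists $i\in\{1,\ldots,k\}$ with $x(\delta(R)\cap T_i)\ge q_i$. Here $\delta(R)$ is the set of edges of $G$ with exactly one end vertex in $R$, and $x(A):=\sum_{e\in A}x_e$ for $A\subseteq E$. Goal: find a feasible solution minimizing its cost $\sum_{e\in E}c_ex_e$. The instance is feasible if a feasible solution exists.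
   Formalization: The edge costs are nonnegative rational numbers, given in binary as numerator and denominator, rather than arbitrary nonnegative real numbers. -}

module Defs where

open import Data.Bool.Base using (if_then_else_; _∧_; _xor_)
open import Data.Fin.Base as Fin using (Fin; toℕ)
open import Data.Fin.Subset using (Subset; _⊆_; _∩_; ⊤; Nonempty)
open import Data.Integer.Base using (+_; ∣_∣)
open import Data.List.Base as List using (List; []; _∷_)
open import Data.Nat.Base using (ℕ; zero; suc; _+_; _*_; _∸_; _^_; _≤_; _≡ᵇ_)
open import Data.Nat.ListAction using (sum)
open import Data.Nat.Logarithm using (⌊log₂_⌋)
import Data.Nat.Properties as ℕ
open import Data.Product.Base using (∃-syntax; _×_; proj₁; proj₂)
open import Data.Rational.Base as ℚ using (ℚ; 0ℚ; ↥_; ↧ₙ_)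
import Data.Rational.Properties as ℚ
open import Data.Vec.Base using (lookup; tabulate)
open import Relation.Binary.PropositionalEquality.Core using (_≡_; _≢_)

import Algebra.Properties.CommutativeMonoid.Sum ℕ.+-0-commutativeMonoid as ∑ℕ
import Algebra.Properties.CommutativeMonoid.Sum ℚ.+-0-commutativeMonoid as ∑ℚ

------------------------------------------------------------------------
-- k-tier Flexible Multigraph Connectivity

-- V = Fin n and E = Fin m, so parallel edges are allowed.  The order of
-- the two ends of an edge carries no meaning.  Costs are rational, as
-- they must be for an instance to be a finite input.  Tiers T₁, …, Tₖ are
-- indexed from 0, so T-last says Tₖ = E.
record Instance (k : ℕ) : Set where
  field
    n m      : ℕ
    ends     : Fin m → Fin n × Fin n
    c        : Fin m → ℚ
    c-nonNeg : ∀ e → 0ℚ ℚ.≤ c e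
    T        : Fin k → Subset m
    T-nested : ∀ {i j} → i Fin.≤ j → T i ⊆ T j
    T-last   : ∀ i → suc (toℕ i) ≡ k → T i ≡ ⊤
    q        : Fin k → ℕ
    q-mono   : ∀ {i j} → i Fin.≤ j → q i ≤ q j

module _ {k : ℕ} (I : Instance k) where
  open Instance I

  Solution : Set
  Solution = Fin m → ℕ

  δ : Subset n → Subset m
  δ R = tabulate λ e → lookup R (proj₁ (ends e)) xor lookup R (proj₂ (ends e))

  total : Solution → Subset m → ℕ
  total x A = ∑ℕ.sum λ e → if lookup A e then x e else 0

  Feasible : Solution → Set
  Feasible x = ∀ (R : Subset n) → Nonempty R → R ≢ ⊤ →
               ∃[ i ] q i ≤ total x (δ R ∩ T i)

  FeasibleInstance : Set
  FeasibleInstance = ∃[ x ] Feasible x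

  cost : Solution → ℚ
  cost x = ∑ℚ.sum λ e → c e ℚ.* (+ x e ℚ./ 1)

  -- Being at most α times the minimum (α ≥ 0) is being at most α times
  -- the cost of each feasible solution.
  Approximate : ℚ → Solution → Set
  Approximate α x = Feasible x × (∀ y → Feasible y → cost x ℚ.≤ α ℚ.* cost y)

------------------------------------------------------------------------
-- The model of computation: a random access machine with logarithmic
-- cost, programmed by structured commands.  Memory is a family of arrays
-- of natural numbers.  A program names arrays by literals only, so it
-- uses finitely many of them; indices are computed.

Memory : Set
Memory = ℕ → ℕ → ℕ

update : Memory → ℕ → ℕ → ℕ → Memory
update M a i v b j = if (a ≡ᵇ b) ∧ (i ≡ᵇ j) then v else M b j

-- The binary length of a number, with 0 written by one digit.
bits : ℕ → ℕ
bits v = suc ⌊log₂ v ⌋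

infix  9 _!_
infixl 7 _⊛_
infixl 6 _⊕_ _⊖_

data Exp : Set where
  lit         : ℕ → Exp
  _!_         : ℕ → Exp → Exp
  _⊕_ _⊖_ _⊛_ : Exp → Exp → Exp

⟦_⟧ : Exp → Memory → ℕ
⟦ lit v ⟧ M = v
⟦ a ! e ⟧ M = M a (⟦ e ⟧ M)
⟦ e ⊕ f ⟧ M = ⟦ e ⟧ M + ⟦ f ⟧ M
⟦ e ⊖ f ⟧ M = ⟦ e ⟧ M ∸ ⟦ f ⟧ M
⟦ e ⊛ f ⟧ M = ⟦ e ⟧ M * ⟦ f ⟧ M

-- Every value that arises, operands and addresses included, is charged
-- its binary length.
time : Exp → Memory → ℕ
subtime : Exp → Memory → ℕ

time e M = bits (⟦ e ⟧ M) + subtime e M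

subtime (lit v) M = 0
subtime (a ! e) M = time e M
subtime (e ⊕ f) M = time e M + time f M
subtime (e ⊖ f) M = time e M + time f M
subtime (e ⊛ f) M = time e M + time f M

infix  5 _!_:=_
infixr 5 if_then_else′_ while_run_
infixr 4 _⨾_

data Program : Set where
  skip            : Program
  _!_:=_          : ℕ → Exp → Exp → Program
  _⨾_             : Program → Program → Program
  if_then_else′_  : Exp → Program → Program → Program
  while_run_      : Exp → Program → Program

-- Run P M t M′: from memory M, program P halts after time t in memory M′.
data Run : Program → Memory → ℕ → Memory → Set where
  run-skip : ∀ {M} → Run skip M 1 M
  run-assign : ∀ {M a e f} →
    Run (a ! e := f) M (1 + time e M + time f M)
        (update M a (⟦ e ⟧ M) (⟦ f ⟧ M))
  run-seq : ∀ {P Q M M′ M″ s t} →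
    Run P M s M′ → Run Q M′ t M″ → Run (P ⨾ Q) M (s + t) M″
  run-then : ∀ {e P Q M M′ t} → ⟦ e ⟧ M ≢ 0 →
    Run P M t M′ → Run (if e then P else′ Q) M (1 + time e M + t) M′
  run-else : ∀ {e P Q M M′ t} → ⟦ e ⟧ M ≡ 0 →
    Run Q M t M′ → Run (if e then P else′ Q) M (1 + time e M + t) M′
  run-exit : ∀ {e P M} → ⟦ e ⟧ M ≡ 0 →
    Run (while e run P) M (1 + time e M) M
  run-loop : ∀ {e P M M′ M″ s t} → ⟦ e ⟧ M ≢ 0 →
    Run P M s M′ → Run (while e run P) M′ t M″ →
    Run (while e run P) M (1 + time e M + s + t) M″

-- Input list j = 0, 1, … is stored in array j + 1; array 0 and all cells
-- beyond the input start as 0.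
Input : Set
Input = List (List ℕ)

inputSize : Input → ℕ
inputSize w = sum (List.map (λ l → sum (List.map bits l)) w)

entry : List ℕ → ℕ → ℕ
entry []       i       = 0
entry (v ∷ vs) zero    = v
entry (v ∷ vs) (suc i) = entry vs i

load : Input → Memory
load w       zero          i = 0
load []      (suc a)       i = 0
load (l ∷ w) (suc zero)    i = entry l i
load (l ∷ w) (suc (suc a)) i = load w (suc a) i

------------------------------------------------------------------------
-- Instances as inputs, solutions as outputs

-- V is written out as a list, so that the size of the input is at least
-- |V| even when there are few edges; the numbers are in binary.
encode : ∀ {k} → Instance k → Input
encode I =
    (n ∷ m ∷ [])
  ∷ List.tabulate {n = n} toℕ
  ∷ List.tabulate q
  ∷ List.tabulate (λ e → toℕ (proj₁ (ends e)))
  ∷ List.tabulate (λ e → toℕ (proj₂ (ends e)))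
  ∷ List.tabulate (λ e → ∣ ↥ c e ∣)
  ∷ List.tabulate (λ e → ↧ₙ c e)
  ∷ List.tabulate (λ i → List.tabulate (λ e → if lookup (T i) e then 1 else 0))
  where open Instance I

output : ∀ {k} (I : Instance k) → Memory → Solution I
output I M e = M 0 (toℕ e)

-- A polynomial-time α-approximation algorithm.  It halts within the time
-- bound on every instance.  A bound a · s ^ d is as general as any
-- polynomial in s, since s ≥ 2 for the size s of an encoded instance.
PolyTimeApproximation : (k : ℕ) → ℚ → Set
PolyTimeApproximation k α =
  ∃[ P ] ∃[ a ] ∃[ d ] ∀ (I : Instance k) →
  ∃[ t ] ∃[ M ] Run P (load (encode I)) t M
              × t ≤ a * inputSize (encode I) ^ d
              × (FeasibleInstance I → Approximate I α (output I M))

module Submission where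

-- Let ℓ(e) be the first tier containing e, and weight e by q_ℓ(e) c_e.  If
-- q₁ = 0 then x = 0 is optimal.  Otherwise take q_ℓ(e) copies of each edge of
-- a minimum-weight spanning tree: a cut contains a tree edge e, and hence
-- satisfies tier ℓ(e).  Conversely, for a feasible x the vector
-- y_e = x_e / q_ℓ(e) has the same cost with respect to the weights, and
-- y(δ(R)) ≥ 1 for each cut, since edges of Tᵢ have q_ℓ(e) ≤ qᵢ.  A minimum
-- spanning tree costs at most twice such a fractional cut cover, by raising
-- the duals of all components uniformly in Kruskal's algorithm.

-- No dual solution is ever constructed. Its effect is an invariant of Kruskal's algorithm that
-- holds against every fractional cover y at once: S + κτ + 2D ≤ 2W, where S is the cost so far, κ
-- the number of components, τ the current threshold, W the weight of y, and D the part of that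
-- weight that lies above τ on crossing edges. A step pays for raising τ out of D, and for the new
-- edge with the component that disappears. Nor is a tree recorded: it is enough that every vertex
-- set crossed by no fully bought edge is a union of label classes. The program does not test
-- feasibility and halts on infeasible instances too; that the instance is feasible serves only to
-- show that a single class remains at the end. The time bound rests on one invariant: cells hold
-- only input numbers, labels and counters, so their length stays within the input size, and
-- products occur only inside expressions. Every loop takes at most that many rounds. The number k
-- must be fixed because each tier is an array of its own and arrays are named by literals, so the
-- program unrolls the search for ℓ(e).

open import Defs

-- Running time of structured programs under logarithmic cost

module LogarithmicCost where

  open import Data.Bool.Base using (true; false; T)
  open import Data.Nat.Base
  open import Data.Nat.Induction using (<-rec)
  open import Data.Nat.Logarithm
  open import Data.Nat.Properties
  open import Data.Product.Base using (∃-syntax; _×_; _,_)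
  open import Data.Unit.Base using (tt)
  open import Relation.Binary.PropositionalEquality
  open import Relation.Nullary.Decidable using (yes; no)
  open import Relation.Nullary.Negation using (contradiction)

  -- Binary length

  bits-mono : ∀ {v w} → v ≤ w → bits v ≤ bits w
  bits-mono v≤w = s≤s (⌊log₂⌋-mono-≤ v≤w)

  2^-mono : ∀ {a b} → a ≤ b → 2 ^ a ≤ 2 ^ b
  2^-mono = ^-monoʳ-≤ 2

  m≤1+2⌊m/2⌋ : ∀ m → m ≤ 1 + 2 * ⌊ m /2⌋
  m≤1+2⌊m/2⌋ m = begin
    m                          ≡⟨ ⌊n/2⌋+⌈n/2⌉≡n m ⟨
    ⌊ m /2⌋ + ⌈ m /2⌉          ≤⟨ +-monoʳ-≤ ⌊ m /2⌋ (⌊n/2⌋-mono {suc m} {2 + m} (n≤1+n _)) ⟩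
    ⌊ m /2⌋ + suc ⌊ m /2⌋      ≡⟨ +-suc _ _ ⟩
    1 + (⌊ m /2⌋ + ⌊ m /2⌋)    ≡⟨ cong (λ x → 1 + (⌊ m /2⌋ + x)) (+-identityʳ _) ⟨
    1 + 2 * ⌊ m /2⌋            ∎
    where open ≤-Reasoning

  -- Strong induction by halving: it lowers the logarithm by one and loses at most the last binary
  -- digit.
  <2^bits : ∀ v → v < 2 ^ bits v
  <2^bits = <-rec (λ v → v < 2 ^ bits v) step
    where
    open ≤-Reasoning
    step : ∀ v → (∀ {h} → h < v → h < 2 ^ bits h) → v < 2 ^ bits v
    step zero            rec = s≤s z≤n
    step (suc zero)      rec = s≤s (s≤s z≤n)
    step v@(suc (suc h)) rec = begin-strict
      v                              <⟨ s≤s (m≤1+2⌊m/2⌋ v) ⟩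
      2 + 2 * ⌊ v /2⌋                ≡⟨ *-suc 2 ⌊ v /2⌋ ⟨
      2 * suc ⌊ v /2⌋                ≤⟨ *-monoʳ-≤ 2 (rec (⌊n/2⌋<n (suc h))) ⟩
      2 * 2 ^ suc ⌊log₂ ⌊ v /2⌋ ⌋    ≡⟨ cong (λ l → 2 * 2 ^ suc l) (⌊log₂⌊n/2⌋⌋≡⌊log₂n⌋∸1 v) ⟩
      2 * 2 ^ suc (⌊log₂ v ⌋ ∸ 1)
        ≡⟨ cong (λ l → 2 * 2 ^ l) (m+[n∸m]≡n {1} (⌊log₂⌋-mono-≤ {2} {v} (s≤s (s≤s z≤n)))) ⟩
      2 ^ bits v                     ∎

  bits-≤2^ : ∀ {v b} → v ≤ 2 ^ b → bits v ≤ suc b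
  bits-≤2^ {b = b} v≤ = s≤s (≤-trans (⌊log₂⌋-mono-≤ v≤) (≤-reflexive (⌊log₂[2^n]⌋≡n b)))

  bits-* : ∀ v w → bits (v * w) ≤ suc (bits v + bits w)
  bits-* v w = bits-≤2^ (≤-trans (*-mono-≤ (<⇒≤ (<2^bits v)) (<⇒≤ (<2^bits w)))
                                 (≤-reflexive (sym (^-distribˡ-+-* 2 (bits v) (bits w)))))

  bits-+ : ∀ v w → bits (v + w) ≤ suc (bits v + bits w)
  bits-+ v w = bits-≤2^ (begin
    v + w
      ≤⟨ +-mono-≤ (v≤ v (m≤m⊔n (bits v) (bits w))) (v≤ w (m≤n⊔m (bits v) (bits w))) ⟩
    2 ^ b + 2 ^ b                  ≡⟨ cong (2 ^ b +_) (+-identityʳ _) ⟨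
    2 ^ suc b
      -- Both lengths are at least 1, so 1 + max is at most min + max, which is their sum.
      ≤⟨ 2^-mono (+-mono-≤ {1} {bits v ⊓ bits w} (⊓-glb (s≤s z≤n) (s≤s z≤n)) ≤-refl) ⟩
    2 ^ (bits v ⊓ bits w + b)      ≡⟨ cong (2 ^_) (trans (+-comm (bits v ⊓ bits w) b) (⊔+⊓ (bits v) (bits w))) ⟩
    2 ^ (bits v + bits w)          ∎)
    where
    open ≤-Reasoning
    b = bits v ⊔ bits w
    ⊔+⊓ : ∀ i j → i ⊔ j + i ⊓ j ≡ i + j
    ⊔+⊓ zero    j       = +-identityʳ j
    ⊔+⊓ (suc i) zero    = refl
    ⊔+⊓ (suc i) (suc j) = cong suc (trans (+-suc _ _) (trans (cong suc (⊔+⊓ i j)) (sym (+-suc i j))))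
    v≤ : ∀ x → bits x ≤ b → x ≤ 2 ^ b
    v≤ x p = ≤-trans (<⇒≤ (<2^bits x)) (2^-mono p)

  -- Polynomial growth

  -- For s ≥ 1 powers grow with the exponent, so bounds with exponents d and e can be added under d
  -- + e.
  Polynomial : (ℕ → ℕ) → Set
  Polynomial f = ∃[ a ] ∃[ d ] ∀ s → 1 ≤ s → f s ≤ a * s ^ d

  poly-const : ∀ a → Polynomial λ _ → a
  poly-const a = a , 0 , λ _ _ → ≤-reflexive (sym (*-identityʳ a))

  poly-id : Polynomial λ s → s
  poly-id = 1 , 1 , λ s _ → ≤-reflexive (sym (trans (+-identityʳ _) (*-identityʳ s)))

  poly-+ : ∀ {f g} → Polynomial f → Polynomial g → Polynomial λ s → f s + g s
  poly-+ {f} {g} (a , d , f≤) (b , e , g≤) = a + b , d + e , λ s 1≤s → begin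
    f s + g s                          ≤⟨ +-mono-≤ (f≤ s 1≤s) (g≤ s 1≤s) ⟩
    a * s ^ d + b * s ^ e
      ≤⟨ +-mono-≤ (*-monoʳ-≤ a (^-mono s 1≤s (m≤m+n d e))) (*-monoʳ-≤ b (^-mono s 1≤s (m≤n+m e d))) ⟩
    a * s ^ (d + e) + b * s ^ (d + e)  ≡⟨ *-distribʳ-+ (s ^ (d + e)) a b ⟨
    (a + b) * s ^ (d + e)              ∎
    where
    open ≤-Reasoning
    ^-mono : ∀ s → 1 ≤ s → ∀ {i j} → i ≤ j → s ^ i ≤ s ^ j
    ^-mono s 1≤s = ^-monoʳ-≤ s {{>-nonZero 1≤s}}

  poly-* : ∀ {f g} → Polynomial f → Polynomial g → Polynomial λ s → f s * g s
  poly-* {f} {g} (a , d , f≤) (b , e , g≤) = a * b , d + e , λ s 1≤s → begin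
    f s * g s                  ≤⟨ *-mono-≤ (f≤ s 1≤s) (g≤ s 1≤s) ⟩
    a * s ^ d * (b * s ^ e)    ≡⟨ [m*n]*[o*p]≡[m*o]*[n*p] a (s ^ d) b (s ^ e) ⟩
    a * b * (s ^ d * s ^ e)    ≡⟨ cong (a * b *_) (^-distribˡ-+-* s d e) ⟨
    a * b * s ^ (d + e)        ∎
    where open ≤-Reasoning

  poly-linear : ∀ a → Polynomial λ s → a * s
  poly-linear a = poly-* (poly-const a) poly-id

  -- Static time bounds

  -- Binary length of a value in units of s. A cell counts 1 since cells are kept within s digits,
  -- and truncated subtraction never exceeds its first operand.
  width : Exp → ℕ
  width (lit v) = bits v
  width (a ! e) = 1
  width (e ⊕ f) = suc (width e + width f)
  width (e ⊖ f) = width e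
  width (e ⊛ f) = suc (width e + width f)

  work : Exp → ℕ
  work (lit v) = width (lit v)
  work (a ! e) = 1 + work e
  work (e ⊕ f) = width (e ⊕ f) + (work e + work f)
  work (e ⊖ f) = width (e ⊖ f) + (work e + work f)
  work (e ⊛ f) = width (e ⊛ f) + (work e + work f)

  -- s bounds the binary length of the cells and the number of rounds of
  -- each loop.
  budget : Program → ℕ → ℕ
  budget skip                    s = 1
  budget (a ! e := f)            s = 1 + work e * s + work f * s
  budget (P ⨾ Q)                 s = budget P s + budget Q s
  budget (if e then P else′ Q)   s = 1 + work e * s + (budget P s + budget Q s)
  budget (while e run P)         s = suc s * (1 + work e * s + budget P s)

  budget-polynomial : ∀ P → Polynomial (budget P)
  budget-polynomial skip         = poly-const 1
  budget-polynomial (a ! e := f) = poly-+ (poly-+ (poly-const 1) (poly-linear (work e))) (poly-linear (work f))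
  budget-polynomial (P ⨾ Q)      = poly-+ (budget-polynomial P) (budget-polynomial Q)
  budget-polynomial (if e then P else′ Q) =
    poly-+ (poly-+ (poly-const 1) (poly-linear (work e)))
           (poly-+ (budget-polynomial P) (budget-polynomial Q))
  budget-polynomial (while e run P) =
    poly-* (poly-+ (poly-const 1) poly-id)
           (poly-+ (poly-+ (poly-const 1) (poly-linear (work e))) (budget-polynomial P))

  update-same : ∀ M a i v → update M a i v a i ≡ v
  update-same M a i v
    with a ≡ᵇ a | ≡⇒≡ᵇ a a refl | i ≡ᵇ i | ≡⇒≡ᵇ i i refl
  ... | true | _ | true | _ = refl

  update-other : ∀ M a v {i j} → i ≢ j → update M a i v a j ≡ M a j
  update-other M a v {i} {j} i≢j with a ≡ᵇ a | i ≡ᵇ j in eq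
  ... | false | _     = refl
  ... | true  | false = refl
  ... | true  | true  = contradiction (≡ᵇ⇒≡ i j (subst T (sym eq) tt)) i≢j

  module Timed (s : ℕ) (1≤s : 1 ≤ s) where

    record Bounded (M : Memory) : Set where
      constructor bounded
      field cell : ∀ a i → bits (M a i) ≤ s

    open Bounded public

    bits-⟦⟧ : ∀ e {M} → Bounded M → bits (⟦ e ⟧ M) ≤ width e * s
    binary : ∀ e f {M z} → Bounded M → z ≤ suc (bits (⟦ e ⟧ M) + bits (⟦ f ⟧ M)) →
             z ≤ suc (width e + width f) * s
    bits-⟦⟧ (lit v) bd = m≤m*n (bits v) s {{>-nonZero 1≤s}}
    bits-⟦⟧ (a ! e) bd = ≤-trans (cell bd a _) (≤-reflexive (sym (+-identityʳ s)))
    bits-⟦⟧ (e ⊕ f) {M} bd = binary e f bd (bits-+ (⟦ e ⟧ M) (⟦ f ⟧ M))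
    bits-⟦⟧ (e ⊖ f) {M} bd = ≤-trans (bits-mono (m∸n≤m (⟦ e ⟧ M) (⟦ f ⟧ M))) (bits-⟦⟧ e bd)
    bits-⟦⟧ (e ⊛ f) {M} bd = binary e f bd (bits-* (⟦ e ⟧ M) (⟦ f ⟧ M))
    binary e f {M} {z} bd z≤ = begin
      z                                        ≤⟨ z≤ ⟩
      1 + (bits (⟦ e ⟧ M) + bits (⟦ f ⟧ M))    ≤⟨ +-mono-≤ 1≤s (+-mono-≤ (bits-⟦⟧ e bd) (bits-⟦⟧ f bd)) ⟩
      s + (width e * s + width f * s)          ≡⟨ cong (s +_) (*-distribʳ-+ s (width e) (width f)) ⟨
      suc (width e + width f) * s              ∎
      where open ≤-Reasoning

    time≤ : ∀ e {M} → Bounded M → time e M ≤ work e * s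
    time₂ : ∀ g e f {M} → Bounded M → bits (⟦ g ⟧ M) + (time e M + time f M) ≤ (width g + (work e + work f)) * s
    time≤ (lit v) bd = ≤-trans (≤-reflexive (+-identityʳ _)) (bits-⟦⟧ (lit v) bd)
    time≤ (a ! e) bd = +-mono-≤ (cell bd a _) (time≤ e bd)
    time≤ (e ⊕ f) bd = time₂ (e ⊕ f) e f bd
    time≤ (e ⊖ f) bd = time₂ (e ⊖ f) e f bd
    time≤ (e ⊛ f) bd = time₂ (e ⊛ f) e f bd
    time₂ g e f {M} bd = begin
      bits (⟦ g ⟧ M) + (time e M + time f M)
        ≤⟨ +-mono-≤ (bits-⟦⟧ g bd) (+-mono-≤ (time≤ e bd) (time≤ f bd)) ⟩
      width g * s + (work e * s + work f * s)    ≡⟨ cong (width g * s +_) (*-distribʳ-+ s (work e) (work f)) ⟨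
      width g * s + (work e + work f) * s        ≡⟨ *-distribʳ-+ s (width g) (work e + work f) ⟨
      (width g + (work e + work f)) * s          ∎
      where open ≤-Reasoning

    update-bounded : ∀ M a i {v} → Bounded M → bits v ≤ s → Bounded (update M a i v)
    update-bounded M a i {v} bd v≤ = bounded at
      where
      at : ∀ b j → bits (update M a i v b j) ≤ s
      at b j with a ≡ᵇ b | i ≡ᵇ j
      ... | false | _     = cell bd b j
      ... | true  | false = cell bd b j
      ... | true  | true  = v≤

    -- A total correctness triple with the static budget and the cell bound built in, so that
    -- composing triples needs no separate account of time.
    Halts : Program → Memory → (Memory → Set) → Set
    Halts P M Post = ∃[ t ] ∃[ M′ ] Run P M t M′ × t ≤ budget P s × Bounded M′ × Post M′

    halts-map : ∀ {P M} {Post Post′ : Memory → Set} → (∀ {M′} → Post M′ → Post′ M′) →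
                Halts P M Post → Halts P M Post′
    halts-map f (t , M′ , r , t≤ , bd , post) = t , M′ , r , t≤ , bd , f post

    halts-skip : ∀ {M} {Post : Memory → Set} → Bounded M → Post M → Halts skip M Post
    halts-skip bd post = 1 , _ , run-skip , ≤-refl , bd , post

    halts-assign : ∀ {M a e f} {Post : Memory → Set} → Bounded M → bits (⟦ f ⟧ M) ≤ s →
                   Post (update M a (⟦ e ⟧ M) (⟦ f ⟧ M)) → Halts (a ! e := f) M Post
    halts-assign {M} {a} {e} {f} bd v≤ post =
      _ , _ , run-assign , s≤s (+-mono-≤ (time≤ e bd) (time≤ f bd)) , update-bounded M a (⟦ e ⟧ M) bd v≤ , post

    halts-seq : ∀ {M P Q} {Mid Post : Memory → Set} → Halts P M Mid →
                (∀ {M′} → Bounded M′ → Mid M′ → Halts Q M′ Post) → Halts (P ⨾ Q) M Post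
    halts-seq (_ , _ , r , t≤ , bd , mid) rest with rest bd mid
    ... | _ , _ , r′ , t′≤ , bd′ , post = _ , _ , run-seq r r′ , +-mono-≤ t≤ t′≤ , bd′ , post

    halts-if : ∀ {M e P Q} {Post : Memory → Set} → Bounded M →
               (⟦ e ⟧ M ≢ 0 → Halts P M Post) → (⟦ e ⟧ M ≡ 0 → Halts Q M Post) →
               Halts (if e then P else′ Q) M Post
    halts-if {M} {e} bd th el with ⟦ e ⟧ M ≟ 0
    ... | yes z with el z
    ...   | _ , _ , r , t≤ , bd′ , post =
      _ , _ , run-else z r , s≤s (+-mono-≤ (time≤ e bd) (≤-trans t≤ (m≤n+m _ _))) , bd′ , post
    halts-if {M} {e} bd th el | no nz with th nz
    ...   | _ , _ , r , t≤ , bd′ , post =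
      _ , _ , run-then nz r , s≤s (+-mono-≤ (time≤ e bd) (≤-trans t≤ (m≤m+n _ _))) , bd′ , post

    -- The index of `Inv` is the variant: it bounds the rounds left, and at 0 the test must fail.
    -- The final index is existential because the test may fail earlier.
    halts-while : ∀ {M e P j} (Inv : ℕ → Memory → Set) →
                  (∀ {M} → Inv 0 M → ⟦ e ⟧ M ≡ 0) →
                  (∀ {j M} → Bounded M → Inv (suc j) M → ⟦ e ⟧ M ≢ 0 → Halts P M (Inv j)) →
                  j ≤ s → Bounded M → Inv j M →
                  Halts (while e run P) M λ M′ → ⟦ e ⟧ M′ ≡ 0 × ∃[ i ] Inv i M′
    halts-while {e = e} {P} Inv last step j≤s bd inv with go _ bd inv
      where
      open ≤-Reasoning
      B = 1 + work e * s + budget P s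
      exit≤ : ∀ {M} → Bounded M → 1 + time e M ≤ B
      exit≤ bd = s≤s (≤-trans (time≤ e bd) (m≤m+n _ _))
      go : ∀ {M} j → Bounded M → Inv j M →
           ∃[ t ] ∃[ M′ ] Run (while e run P) M t M′ × t ≤ suc j * B × Bounded M′ × ⟦ e ⟧ M′ ≡ 0 × ∃[ i ] Inv i M′
      go zero bd inv =
        _ , _ , run-exit (last inv) , ≤-trans (exit≤ bd) (m≤m+n B _) , bd , last inv , 0 , inv
      go {M} (suc j) bd inv with ⟦ e ⟧ M ≟ 0
      ... | yes z = _ , _ , run-exit z , ≤-trans (exit≤ bd) (m≤m+n B _) , bd , z , suc j , inv
      ... | no nz with step bd inv nz
      ...   | t , _ , r , t≤ , bd′ , inv′ with go j bd′ inv′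
      ...     | t′ , _ , r′ , t′≤ , bd″ , post =
        _ , _ , run-loop nz r r′ , +-mono-≤ (+-mono-≤ (s≤s (time≤ e bd)) t≤) t′≤ , bd″ , post
    ... | t , _ , r , t≤ , bd′ , post =
      t , _ , r , ≤-trans t≤ (*-monoˡ-≤ (1 + work e * s + budget P s) (s≤s j≤s)) , bd′ , post

    -- An upward count as an instance of `halts-while`: the variant is the j with i + j ≡ N.
    halts-for : ∀ {M e P} N (Inv : ℕ → Memory → Set) →
                (∀ {i M} → Inv i M → ⟦ e ⟧ M ≡ N ∸ i) →
                (∀ {i M} → Bounded M → i < N → Inv i M → Halts P M (Inv (suc i))) →
                N ≤ s → Bounded M → Inv 0 M → Halts (while e run P) M (Inv N)
    halts-for {e = e} N Inv test step N≤s bd inv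
      with halts-while (λ j M → ∃[ i ] i + j ≡ N × Inv i M)
             (λ { (i , eq , inv) → trans (test inv) (m≤n⇒m∸n≡0 (≤-reflexive (trans (sym eq) (+-identityʳ i)))) })
             (λ { {j} bd (i , eq , inv) _ →
                  let (t , M′ , r , t≤ , bd′ , inv′) =
                        step bd (≤-trans (s≤s (m≤m+n i j)) (≤-reflexive (trans (sym (+-suc i j)) eq))) inv
                  in t , M′ , r , t≤ , bd′ , suc i , trans (sym (+-suc i j)) eq , inv′ })
             N≤s bd (0 , refl , inv)
    ... | t , M′ , r , t≤ , bd′ , z , j , i , eq , inv′ =
      t , M′ , r , t≤ , bd′ , subst (λ i → Inv i M′) i≡N inv′
      where
      -- The variant gives i ≤ N, and the failed test N ∸ i ≡ 0 gives the converse.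
      i≡N : i ≡ N
      i≡N = ≤-antisym (≤-trans (m≤m+n i j) (≤-reflexive eq))
                      (m∸n≡0⇒m≤n (trans (sym (test inv′)) z))

-- Rational sums, and Kruskal's algorithm against fractional cut covers

module FractionalCuts where

  open import Algebra.Bundles using (CommutativeRing)
  open import Data.Bool.Base using (Bool; true; false; if_then_else_; not; _xor_)
  import Data.Bool.Properties as 𝔹
  open import Data.Fin.Base using (Fin; zero; suc)
  open import Data.Fin.Properties using (_≟_)
  import Data.Integer.Base as ℤ
  import Data.Integer.Properties as ℤ
  open import Data.Nat.Base as ℕ using (ℕ; zero; suc)
  import Data.Nat.Properties as ℕ
  open import Data.Product.Base using (∃-syntax; _,_; proj₂)
  open import Data.Rational.Base as ℚ
    using (ℚ; 0ℚ; 1ℚ; _+_; _*_; _-_; -_; _≤_; _/_; toℚᵘ; nonNegative)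
  open import Data.Rational.Properties hiding (_≟_)
  open import Data.Rational.Solver using (module +-*-Solver)
  open import Data.Rational.Unnormalised.Base as ℚᵘ using (mkℚᵘ; *≡*; *≤*)
  import Data.Rational.Unnormalised.Properties as ℚᵘ
  open import Function.Base using (_∘_)
  open import Relation.Binary.PropositionalEquality
  open import Relation.Nullary.Decidable using (yes; no; does; dec-true; dec-false)

  import Algebra.Properties.CommutativeMonoid.Sum ℕ.+-0-commutativeMonoid as ∑ℕ
  import Algebra.Properties.CommutativeMonoid.Sum +-0-commutativeMonoid as ∑ℚ
  open import Algebra.Properties.Semiring.Sum (CommutativeRing.semiring +-*-commutativeRing)
    using (*-distribˡ-sum)

  -- Opaque, since unfolding ι exposes the gcd in the normalisation of fractions.
  opaque
    ι : ℕ → ℚ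
    ι j = ℤ.+ j / 1

    -- inv 0 = 0 is a junk value.
    inv : ℕ → ℚ
    inv zero    = 0ℚ
    inv (suc j) = ℤ.+ 1 / suc j

    /1≡ι : ∀ j → ℤ.+ j / 1 ≡ ι j
    /1≡ι j = refl

    ι-0 : ι 0 ≡ 0ℚ
    ι-0 = refl

    ι-1 : ι 1 ≡ 1ℚ
    ι-1 = refl

    inv-0 : inv 0 ≡ 0ℚ
    inv-0 = refl

    toℚᵘ-ι : ∀ j → toℚᵘ (ι j) ℚᵘ.≃ mkℚᵘ (ℤ.+ j) 0
    toℚᵘ-ι j = toℚᵘ-fromℚᵘ (mkℚᵘ (ℤ.+ j) 0)

    toℚᵘ-inv : ∀ j → toℚᵘ (inv (suc j)) ℚᵘ.≃ mkℚᵘ (ℤ.+ 1) j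
    toℚᵘ-inv j = toℚᵘ-fromℚᵘ (mkℚᵘ (ℤ.+ 1) j)

  ι-+ : ∀ i j → ι (i ℕ.+ j) ≡ ι i + ι j
  ι-+ i j = toℚᵘ-injective (begin
    toℚᵘ (ι (i ℕ.+ j))                ≈⟨ toℚᵘ-ι (i ℕ.+ j) ⟩
    mkℚᵘ (ℤ.+ (i ℕ.+ j)) 0            ≈⟨ *≡* (cong (ℤ._* ℤ.1ℤ) numerators) ⟩
    mkℚᵘ (ℤ.+ i) 0 ℚᵘ.+ mkℚᵘ (ℤ.+ j) 0 ≈⟨ ℚᵘ.+-cong (toℚᵘ-ι i) (toℚᵘ-ι j) ⟨
    toℚᵘ (ι i) ℚᵘ.+ toℚᵘ (ι j)        ≈⟨ toℚᵘ-homo-+ (ι i) (ι j) ⟨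
    toℚᵘ (ι i + ι j)                  ∎)
    where
    open ℚᵘ.≃-Reasoning
    numerators : ℤ.+ (i ℕ.+ j) ≡ ℤ.+ i ℤ.* ℤ.1ℤ ℤ.+ ℤ.+ j ℤ.* ℤ.1ℤ
    numerators = trans (ℤ.pos-+ i j) (sym (cong₂ ℤ._+_ (ℤ.*-identityʳ (ℤ.+ i)) (ℤ.*-identityʳ (ℤ.+ j))))

  ι-mono : ∀ {i j} → i ℕ.≤ j → ι i ≤ ι j
  ι-mono {i} {j} i≤j = toℚᵘ-cancel-≤
    (ℚᵘ.≤-respˡ-≃ (ℚᵘ.≃-sym (toℚᵘ-ι i)) (ℚᵘ.≤-respʳ-≃ (ℚᵘ.≃-sym (toℚᵘ-ι j))
      (*≤* (ℤ.*-monoʳ-≤-nonNeg ℤ.1ℤ (ℤ.+≤+ i≤j)))))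

  ι-nonNeg : ∀ j → 0ℚ ≤ ι j
  ι-nonNeg j = subst (_≤ ι j) ι-0 (ι-mono ℕ.z≤n)

  inv-nonNeg : ∀ j → 0ℚ ≤ inv j
  inv-nonNeg zero    = ≤-reflexive (sym inv-0)
  inv-nonNeg (suc j) = toℚᵘ-cancel-≤
    (ℚᵘ.≤-respʳ-≃ (ℚᵘ.≃-sym (toℚᵘ-inv j)) (*≤* (ℤ.+≤+ ℕ.z≤n)))

  ι*inv : ∀ {j} → 1 ℕ.≤ j → ι j * inv j ≡ 1ℚ
  ι*inv {suc j} _ = toℚᵘ-injective (begin
    toℚᵘ (ι (suc j) * inv (suc j))             ≈⟨ toℚᵘ-homo-* (ι (suc j)) (inv (suc j)) ⟩
    toℚᵘ (ι (suc j)) ℚᵘ.* toℚᵘ (inv (suc j))   ≈⟨ ℚᵘ.*-cong (toℚᵘ-ι (suc j)) (toℚᵘ-inv j) ⟩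
    mkℚᵘ (ℤ.+ suc j) 0 ℚᵘ.* mkℚᵘ (ℤ.+ 1) j         ≈⟨ *≡* cross-product ⟩
    mkℚᵘ (ℤ.+ 1) 0                               ∎)
    where
    open ℚᵘ.≃-Reasoning
    cross-product : ℤ.+ suc j ℤ.* ℤ.1ℤ ℤ.* ℤ.1ℤ ≡ ℤ.1ℤ ℤ.* ℤ.+ suc (j ℕ.+ 0)
    cross-product = trans (ℤ.*-identityʳ _) (trans (ℤ.*-identityʳ (ℤ.+ suc j))
      (sym (trans (ℤ.*-identityˡ _) (cong (λ x → ℤ.+ suc x) (ℕ.+-identityʳ j)))))

  *-monoˡ : ∀ {r x y} → 0ℚ ≤ r → x ≤ y → r * x ≤ r * y
  *-monoˡ {r} 0≤r = *-monoˡ-≤-nonNeg r {{nonNegative 0≤r}}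

  *-monoʳ : ∀ {r x y} → 0ℚ ≤ r → x ≤ y → x * r ≤ y * r
  *-monoʳ {r} 0≤r = *-monoʳ-≤-nonNeg r {{nonNegative 0≤r}}

  *-nonNeg : ∀ {x y} → 0ℚ ≤ x → 0ℚ ≤ y → 0ℚ ≤ x * y
  *-nonNeg {x} {y} 0≤x 0≤y = subst (_≤ x * y) (*-zeroʳ x) (*-monoˡ 0≤x 0≤y)

  +-nonNeg : ∀ {x y} → 0ℚ ≤ x → 0ℚ ≤ y → 0ℚ ≤ x + y
  +-nonNeg 0≤x 0≤y = +-mono-≤ 0≤x 0≤y

  x≤x+y : ∀ {x y} → 0ℚ ≤ y → x ≤ x + y
  x≤x+y {x} {y} 0≤y = subst (_≤ x + y) (+-identityʳ x) (+-monoʳ-≤ x 0≤y)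

  y-x-nonNeg : ∀ {x y} → x ≤ y → 0ℚ ≤ y - x
  y-x-nonNeg {x} {y} x≤y = subst (_≤ y - x) (+-inverseʳ x) (+-monoˡ-≤ (- x) x≤y)

  inv-antitone : ∀ {i j} → 1 ℕ.≤ i → i ℕ.≤ j → inv j ≤ inv i
  inv-antitone {i} {j} 1≤i i≤j = begin
    inv j                      ≡⟨ *-identityʳ (inv j) ⟨
    inv j * 1ℚ                 ≡⟨ cong (inv j *_) (ι*inv 1≤i) ⟨
    inv j * (ι i * inv i)      ≤⟨ *-monoˡ (inv-nonNeg j) (*-monoʳ (inv-nonNeg i) (ι-mono i≤j)) ⟩
    inv j * (ι j * inv i)      ≡⟨ solve 3 (λ a b c → a :* (b :* c) := b :* a :* c) refl (inv j) (ι j) (inv i) ⟩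
    ι j * inv j * inv i        ≡⟨ cong (_* inv i) (ι*inv (ℕ.≤-trans 1≤i i≤j)) ⟩
    1ℚ * inv i                 ≡⟨ *-identityˡ (inv i) ⟩
    inv i                      ∎
    where
    open ≤-Reasoning
    open +-*-Solver


  on : Bool → ℚ → ℚ
  on b p = if b then p else 0ℚ

  on-nonNeg : ∀ b {p} → 0ℚ ≤ p → 0ℚ ≤ on b p
  on-nonNeg true  0≤p = 0≤p
  on-nonNeg false 0≤p = ≤-refl

  ∑-mono : ∀ {n} {f g : Fin n → ℚ} → (∀ i → f i ≤ g i) → ∑ℚ.sum f ≤ ∑ℚ.sum g
  ∑-mono {zero}  f≤g = ≤-refl
  ∑-mono {suc n} f≤g = +-mono-≤ (f≤g zero) (∑-mono (f≤g ∘ suc))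

  ∑-zero : ∀ {n} {f : Fin n → ℚ} → (∀ i → f i ≡ 0ℚ) → ∑ℚ.sum f ≡ 0ℚ
  ∑-zero {n} f≡0 = trans (∑ℚ.sum-cong-≗ f≡0) (∑ℚ.sum-replicate-zero n)

  ∑-nonNeg : ∀ {n} {f : Fin n → ℚ} → (∀ i → 0ℚ ≤ f i) → 0ℚ ≤ ∑ℚ.sum f
  ∑-nonNeg {n} {f} 0≤f = subst (_≤ ∑ℚ.sum f) (∑ℚ.sum-replicate-zero n) (∑-mono 0≤f)

  ∑-select : ∀ {n} (l : Fin n) y → ∑ℚ.sum (λ a → on (does (l ≟ a)) y) ≡ y
  ∑-select {suc n} zero y =
    trans (cong (y +_) (∑-zero {n} {f = λ a → on (does (zero ≟ suc a)) y} λ _ → refl)) (+-identityʳ y)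
  ∑-select {suc n} (suc l) y = trans (+-identityˡ _) (∑-select l y)

  ι-∑ : ∀ {n} (f : Fin n → ℕ) → ι (∑ℕ.sum f) ≡ ∑ℚ.sum (ι ∘ f)
  ι-∑ {zero}  f = ι-0
  ι-∑ {suc n} f = trans (ι-+ (f zero) (∑ℕ.sum (f ∘ suc))) (cong (ι (f zero) +_) (ι-∑ (f ∘ suc)))

  ∑ℕ-mono : ∀ {n} {f g : Fin n → ℕ} → (∀ i → f i ℕ.≤ g i) → ∑ℕ.sum f ℕ.≤ ∑ℕ.sum g
  ∑ℕ-mono {zero}  f≤g = ℕ.z≤n
  ∑ℕ-mono {suc n} f≤g = ℕ.+-mono-≤ (f≤g zero) (∑ℕ-mono (f≤g ∘ suc))

  ∑ℕ-mono-< : ∀ {n} {f g : Fin n → ℕ} i → (∀ i → f i ℕ.≤ g i) → f i ℕ.< g i → ∑ℕ.sum f ℕ.< ∑ℕ.sum g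
  ∑ℕ-mono-< zero    f≤g f<g = ℕ.+-mono-<-≤ f<g (∑ℕ-mono (f≤g ∘ suc))
  ∑ℕ-mono-< (suc i) f≤g f<g = ℕ.+-mono-≤-< (f≤g zero) (∑ℕ-mono-< i (f≤g ∘ suc) f<g)

  ∑ℕ-term : ∀ {n} (f : Fin n → ℕ) i → f i ℕ.≤ ∑ℕ.sum f
  ∑ℕ-term f zero    = ℕ.m≤m+n _ _
  ∑ℕ-term f (suc i) = ℕ.≤-trans (∑ℕ-term (f ∘ suc) i) (ℕ.m≤n+m _ _)

  ∑ℕ-≤ : ∀ {n} (f : Fin n → ℕ) → (∀ i → f i ℕ.≤ 1) → ∑ℕ.sum f ℕ.≤ n
  ∑ℕ-≤ {zero}  f f≤1 = ℕ.z≤n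
  ∑ℕ-≤ {suc n} f f≤1 = ℕ.+-mono-≤ (f≤1 zero) (∑ℕ-≤ (f ∘ suc) (f≤1 ∘ suc))

  -- Kruskal's algorithm on component labels

  module Kruskal {n m : ℕ} (u v : Fin m → Fin n) (w : Fin m → ℚ) (w-nonNeg : ∀ e → 0ℚ ≤ w e) where

    Labels : Set
    Labels = Fin n → Fin n

    -- Each label is a member of the class it names, so classes correspond to fixed points of the
    -- labelling, and these are what `components` counts.
    Rooted : Labels → Set
    Rooted lab = ∀ a → lab (lab a) ≡ lab a

    crossing : Labels → Fin m → Bool
    crossing lab e = not (does (lab (u e) ≟ lab (v e)))

    live : Labels → Fin n → Bool
    live lab a = does (lab a ≟ a)

    components : Labels → ℕ
    components lab = ∑ℕ.sum λ a → if live lab a then 1 else 0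

    merge : Labels → Fin n → Fin n → Labels
    merge lab a b c = if does (lab c ≟ b) then a else lab c

    -- The constraints of the undirected cut relaxation; a vertex on each side witnesses that R is
    -- nonempty and proper.
    FractionalCover : (Fin m → ℚ) → Set
    FractionalCover y = ∀ (R : Fin n → Bool) {a b} → R a ≡ true → R b ≡ false →
                        1ℚ ≤ ∑ℚ.sum λ e → on (R (u e) xor R (v e)) (y e)

    -- The potential argument: τ is the weight of the last edge chosen.  When
    -- τ rises to w, each of the κ components pays w − τ out of the cover of
    -- its own cut, and each crossing edge is in two such cuts.
    record Dual (lab : Labels) (S : ℚ) : Set where
      field
        τ        : ℚ
        τ-nonNeg : 0ℚ ≤ τ
        τ≤w      : ∀ e → crossing lab e ≡ true → τ ≤ w e
        bound    : ∀ y → (∀ e → 0ℚ ≤ y e) → FractionalCover y →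
                   let D = ∑ℚ.sum λ e → on (crossing lab e) ((w e - τ) * y e)
                       W = ∑ℚ.sum λ e → w e * y e
                   in S + ι (components lab) * τ + (D + D) ≤ W + W

    module _ (lab : Labels) {e₀ : Fin m} (cross₀ : crossing lab e₀ ≡ true)
             {y : Fin m → ℚ} (y-nonNeg : ∀ e → 0ℚ ≤ y e) (cover : FractionalCover y) where

      -- The ends of a crossing edge have different labels, so one of them lies outside the class of
      -- a. Hence each class is a proper side of a cut.
      outside : ∀ a → ∃[ b ] does (lab b ≟ a) ≡ false
      outside a with lab (u e₀) ≟ a in eq₁ | lab (v e₀) ≟ a in eq₂
      ... | no _  | _    = u e₀ , cong does eq₁
      ... | yes _ | no _ = v e₀ , cong does eq₂
      ... | yes p | yes q
        with () ← trans (sym cross₀) (cong not (dec-true (lab (u e₀) ≟ lab (v e₀)) (trans p (sym q))))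

      cut : Fin n → Fin m → ℚ
      cut a e = on (does (lab (u e) ≟ a) xor does (lab (v e) ≟ a)) (y e)

      component-covered : ∀ a → ι (if live lab a then 1 else 0) ≤ ∑ℚ.sum (cut a)
      component-covered a with live lab a in eq
      ... | false = ≤-trans (≤-reflexive ι-0) (∑-nonNeg λ e →
        on-nonNeg (does (lab (u e) ≟ a) xor does (lab (v e) ≟ a)) (y-nonNeg e))
      -- A live label lies in its own class, which is therefore nonempty.
      ... | true  = ≤-trans (≤-reflexive ι-1) (cover (λ b → does (lab b ≟ a)) eq (proj₂ (outside a)))

      -- An edge lies only in the cuts of the classes of its two ends, and in none if these classes
      -- agree.
      cut-twice : ∀ e → ∑ℚ.sum (λ a → cut a e) ≤ on (crossing lab e) (y e) + on (crossing lab e) (y e)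
      cut-twice e with lab (u e) ≟ lab (v e)
      ... | yes p = ≤-reflexive (trans (∑-zero λ a → cong (λ b → on b (y e)) (same a)) (sym (+-identityˡ 0ℚ)))
        where
        same : ∀ a → does (lab (u e) ≟ a) xor does (lab (v e) ≟ a) ≡ false
        same a = trans (cong (λ l → does (l ≟ a) xor does (lab (v e) ≟ a)) p) (𝔹.xor-same (does (lab (v e) ≟ a)))
      ... | no _ = begin
        ∑ℚ.sum (λ a → cut a e)
          ≤⟨ ∑-mono (λ a → xor≤ (does (lab (u e) ≟ a)) (does (lab (v e) ≟ a))) ⟩
        ∑ℚ.sum (λ a → on (does (lab (u e) ≟ a)) (y e) + on (does (lab (v e) ≟ a)) (y e))
          ≡⟨ ∑ℚ.∑-distrib-+ (λ a → on (does (lab (u e) ≟ a)) (y e)) _ ⟩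
        ∑ℚ.sum (λ a → on (does (lab (u e) ≟ a)) (y e)) + ∑ℚ.sum (λ a → on (does (lab (v e) ≟ a)) (y e))
          ≡⟨ cong₂ _+_ (∑-select (lab (u e)) (y e)) (∑-select (lab (v e)) (y e)) ⟩
        y e + y e                                                                    ∎
        where
        open ≤-Reasoning
        xor≤ : ∀ p q → on (p xor q) (y e) ≤ on p (y e) + on q (y e)
        xor≤ true  true  = +-nonNeg (y-nonNeg e) (y-nonNeg e)
        xor≤ true  false = ≤-reflexive (sym (+-identityʳ (y e)))
        xor≤ false q     = ≤-reflexive (sym (+-identityˡ _))

      -- Double counting of pairs of a class and an edge of its cut. This is where the factor 2 of
      -- the approximation arises.
      components≤ : let Y = ∑ℚ.sum λ e → on (crossing lab e) (y e) in ι (components lab) ≤ Y + Y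
      components≤ = begin
        ι (components lab)                                     ≡⟨ ι-∑ (λ a → if live lab a then 1 else 0) ⟩
        ∑ℚ.sum (λ a → ι (if live lab a then 1 else 0))         ≤⟨ ∑-mono component-covered ⟩
        ∑ℚ.sum (λ a → ∑ℚ.sum (cut a))                          ≡⟨ ∑ℚ.∑-comm cut ⟩
        ∑ℚ.sum (λ e → ∑ℚ.sum (λ a → cut a e))                  ≤⟨ ∑-mono cut-twice ⟩
        ∑ℚ.sum (λ e → on (crossing lab e) (y e) + on (crossing lab e) (y e))
          ≡⟨ ∑ℚ.∑-distrib-+ (λ e → on (crossing lab e) (y e)) _ ⟩
        _                                                      ∎
        where open ≤-Reasoning

    -- At τ = 0 the component term vanishes and D is a partial sum of W.
    dual-init : Dual (λ a → a) 0ℚ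
    dual-init = record
      { τ        = 0ℚ
      ; τ-nonNeg = ≤-refl
      ; τ≤w      = λ e _ → w-nonNeg e
      ; bound    = λ y y-nonNeg _ →
          let D = ∑ℚ.sum λ e → on (crossing (λ a → a) e) ((w e - 0ℚ) * y e)
              κ = ι (components λ a → a)
          in ≤-trans
               (≤-reflexive (trans (cong (_+ (D + D)) (trans (+-identityˡ (κ * 0ℚ)) (*-zeroʳ κ))) (+-identityˡ (D + D))))
               (+-mono-≤ (∑-mono (term y y-nonNeg)) (∑-mono (term y y-nonNeg)))
      }
      where
      term : ∀ y → (∀ e → 0ℚ ≤ y e) → ∀ e → on (crossing (λ a → a) e) ((w e - 0ℚ) * y e) ≤ w e * y e
      term y y-nonNeg e with crossing (λ a → a) e
      ... | true  = ≤-reflexive (cong (_* y e) (+-identityʳ (w e)))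
      ... | false = *-nonNeg (w-nonNeg e) (y-nonNeg e)

    module _ {lab : Labels} (rooted : Rooted lab) {e₀ : Fin m} (cross₀ : crossing lab e₀ ≡ true) where

      private
        a b : Fin n
        a = lab (u e₀)
        b = lab (v e₀)
        lab′ : Labels
        lab′ = merge lab a b
        a≢b : a ≢ b
        a≢b eq with () ← trans (sym cross₀) (cong not (dec-true (a ≟ b) eq))

      merge-rooted : Rooted lab′
      merge-rooted c with lab c ≟ b
      ... | yes p rewrite dec-false (lab a ≟ b) (λ eq → a≢b (trans (sym (rooted (u e₀))) eq)) = rooted (u e₀)
      ... | no ¬p rewrite dec-false (lab (lab c) ≟ b) (λ eq → ¬p (trans (sym (rooted c)) eq)) = rooted c

      -- No vertex becomes a representative, and b, which was one, ceases to be.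
      merge-components : components lab′ ℕ.< components lab
      merge-components = ∑ℕ-mono-< b all-≤ at-b
        where
        all-≤ : ∀ c → (if live lab′ c then 1 else 0) ℕ.≤ (if live lab c then 1 else 0)
        all-≤ c with lab c ≟ c
        ... | yes _ = 𝔹≤1 (live lab′ c)
          where
          𝔹≤1 : ∀ t → (if t then 1 else 0) ℕ.≤ 1
          𝔹≤1 true  = ℕ.≤-refl
          𝔹≤1 false = ℕ.z≤n
        ... | no ¬p = ℕ.≤-reflexive (cong (if_then 1 else 0) (dec-false (lab′ c ≟ c) λ eq → ¬p (back eq)))
          where
          back : lab′ c ≡ c → lab c ≡ c
          back eq with lab c ≟ b
          ... | yes _ = trans (cong lab (sym eq)) (trans (rooted (u e₀)) eq)
          ... | no _  = eq
        at-b : (if live lab′ b then 1 else 0) ℕ.< (if live lab b then 1 else 0)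
        at-b rewrite dec-true (lab b ≟ b) (rooted (v e₀)) | dec-false (a ≟ b) a≢b = ℕ.≤-refl

      merge-crossing : ∀ e → crossing lab′ e ≡ true → crossing lab e ≡ true
      merge-crossing e cross′ with lab (u e) ≟ lab (v e)
      ... | no _  = refl
      ... | yes p
        with () ← trans (sym cross′) (cong not (dec-true (lab′ (u e) ≟ lab′ (v e)) (cong (λ l → if does (l ≟ b) then a else l) p)))

      -- The lost component absorbs the new edge: w₀ + κ′ w₀ ≤ κ w₀. What remains is κ (w₀ - τ), at
      -- most 2 Y (w₀ - τ) by `components≤`, and D shrinks by at least Y (w₀ - τ).
      dual-step : ∀ {S S′} → (∀ e → crossing lab e ≡ true → w e₀ ≤ w e) → S′ ≤ S + w e₀ → Dual lab S → Dual lab′ S′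
      dual-step {S} {S′} minimal S′≤ dual = record
        { τ        = w₀
        ; τ-nonNeg = w-nonNeg e₀
        ; τ≤w      = λ e cross′ → minimal e (merge-crossing e cross′)
        ; bound    = bound′
        }
        where
        open Dual dual
        open ≤-Reasoning
        open +-*-Solver
        w₀ = w e₀
        κ = ι (components lab)
        κ′ = ι (components lab′)
        κ′+1≤κ : κ′ + 1ℚ ≤ κ
        κ′+1≤κ = ≤-trans
          (≤-reflexive (trans (+-comm κ′ 1ℚ) (trans (cong (_+ κ′) (sym ι-1)) (sym (ι-+ 1 (components lab′))))))
          (ι-mono merge-components)
        bound′ : ∀ y → (∀ e → 0ℚ ≤ y e) → FractionalCover y →
                 let D = ∑ℚ.sum λ e → on (crossing lab′ e) ((w e - w₀) * y e)
                     W = ∑ℚ.sum λ e → w e * y e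
                 in S′ + κ′ * w₀ + (D + D) ≤ W + W
        bound′ y y-nonNeg cover = begin
          S′ + κ′ * w₀ + (D′ + D′)                     ≤⟨ +-monoˡ-≤ (D′ + D′) (+-monoˡ-≤ (κ′ * w₀) S′≤) ⟩
          S + w₀ + κ′ * w₀ + (D′ + D′)
            ≡⟨ solve 4 (λ s w k d → s :+ w :+ k :* w :+ d := s :+ (k :+ con 1ℚ) :* w :+ d) refl S w₀ κ′ (D′ + D′) ⟩
          S + (κ′ + 1ℚ) * w₀ + (D′ + D′)
            ≤⟨ +-monoˡ-≤ (D′ + D′) (+-monoʳ-≤ S (*-monoʳ (w-nonNeg e₀) κ′+1≤κ)) ⟩
          S + κ * w₀ + (D′ + D′)
            ≡⟨ solve 5 (λ s w t k d → s :+ k :* w :+ d := s :+ k :* t :+ (d :+ k :* (w :- t))) refl S w₀ τ κ (D′ + D′) ⟩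
          S + κ * τ + (D′ + D′ + κ * (w₀ - τ))
            ≤⟨ +-monoʳ-≤ (S + κ * τ) (+-monoʳ-≤ (D′ + D′) (*-monoʳ 0≤w₀-τ (components≤ lab cross₀ y-nonNeg cover))) ⟩
          S + κ * τ + (D′ + D′ + (Y + Y) * (w₀ - τ))
            ≡⟨ cong (S + κ * τ +_) (solve 3 (λ d y w → d :+ d :+ (y :+ y) :* w := (d :+ w :* y) :+ (d :+ w :* y)) refl D′ Y (w₀ - τ)) ⟩
          S + κ * τ + ((D′ + (w₀ - τ) * Y) + (D′ + (w₀ - τ) * Y))
            ≤⟨ +-monoʳ-≤ (S + κ * τ) (+-mono-≤ D′≤D D′≤D) ⟩
          S + κ * τ + (D + D)                          ≤⟨ bound y y-nonNeg cover ⟩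
          W + W                                        ∎
          where
          D′ = ∑ℚ.sum λ e → on (crossing lab′ e) ((w e - w₀) * y e)
          D = ∑ℚ.sum λ e → on (crossing lab e) ((w e - τ) * y e)
          Y = ∑ℚ.sum λ e → on (crossing lab e) (y e)
          W = ∑ℚ.sum λ e → w e * y e
          0≤w₀-τ : 0ℚ ≤ w₀ - τ
          0≤w₀-τ = y-x-nonNeg (τ≤w e₀ cross₀)
          term : ∀ e → on (crossing lab′ e) ((w e - w₀) * y e) + (w₀ - τ) * on (crossing lab e) (y e) ≤
                       on (crossing lab e) ((w e - τ) * y e)
          term e with crossing lab′ e in eq′ | crossing lab e in eq
          ... | true  | true  = ≤-reflexive
            (solve 4 (λ x w t y → (x :- w) :* y :+ (w :- t) :* y := (x :- t) :* y) refl (w e) w₀ τ (y e))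
          ... | true  | false with () ← trans (sym eq) (merge-crossing e eq′)
          -- An edge inside the merged class leaves D′ altogether. Its old term w e - τ pays w₀ - τ
          -- because e₀ was a cheapest crossing edge.
          term e | false | true  = ≤-trans
            (≤-reflexive (+-identityˡ _)) (*-monoʳ (y-nonNeg e) (+-monoˡ-≤ (- τ) (minimal e eq)))
          term e | false | false = ≤-reflexive (trans (+-identityˡ _) (*-zeroʳ (w₀ - τ)))
          D′≤D : D′ + (w₀ - τ) * Y ≤ D
          D′≤D = begin
            D′ + (w₀ - τ) * Y   ≡⟨ cong (D′ +_) (*-distribˡ-sum (w₀ - τ) (λ e → on (crossing lab e) (y e))) ⟩
            D′ + ∑ℚ.sum (λ e → (w₀ - τ) * on (crossing lab e) (y e))
              ≡⟨ ∑ℚ.∑-distrib-+ (λ e → on (crossing lab′ e) ((w e - w₀) * y e)) _ ⟨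
            ∑ℚ.sum (λ e → on (crossing lab′ e) ((w e - w₀) * y e) + (w₀ - τ) * on (crossing lab e) (y e))
              ≤⟨ ∑-mono term ⟩
            D                   ∎

    dual-final : ∀ {lab S} → Dual lab S → ∀ y → (∀ e → 0ℚ ≤ y e) → FractionalCover y →
                 let W = ∑ℚ.sum λ e → w e * y e in S ≤ W + W
    dual-final {lab} {S} dual y y-nonNeg cover =
      ≤-trans (≤-trans (x≤x+y (*-nonNeg (ι-nonNeg (components lab)) τ-nonNeg)) (x≤x+y (+-nonNeg 0≤D 0≤D)))
              (bound y y-nonNeg cover)
      where
      open Dual dual
      term : ∀ e → 0ℚ ≤ on (crossing lab e) ((w e - τ) * y e)
      term e with crossing lab e in eq
      ... | true  = *-nonNeg (y-x-nonNeg (τ≤w e eq)) (y-nonNeg e)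
      ... | false = ≤-refl
      0≤D = ∑-nonNeg term

-- From tiers to weighted spanning trees

module TierReduction where

  open FractionalCuts
  open import Algebra.Bundles using (CommutativeRing)
  open import Data.Bool.Base using (Bool; true; false; if_then_else_; _xor_; _∧_)
  import Data.Bool.Properties as 𝔹
  open import Data.Fin.Base as Fin using (Fin; zero; suc)
  open import Data.Fin.Properties as Fin using (_≟_; any?)
  open import Data.Fin.Subset using (⊤; _∩_)
  import Data.Integer.Base as ℤ
  open import Data.Nat.Base as ℕ using (ℕ; zero; suc)
  import Data.Nat.Properties as ℕ
  open import Data.Product.Base using (∃-syntax; _×_; _,_; proj₁; proj₂)
  open import Data.Rational.Base as ℚ using (ℚ; 0ℚ; 1ℚ; _+_; _*_; _≤_; _/_)
  open import Data.Rational.Properties hiding (_≟_)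
  open import Data.Rational.Solver using (module +-*-Solver)
  open import Data.Vec.Base using (lookup; tabulate)
  open import Data.Vec.Properties
    using (lookup∘tabulate; tabulate∘lookup; lookup-zipWith; lookup-replicate; tabulate-cong; lookup⇒[]=; []=⇒lookup)
  open import Function.Base using (_∘_)
  open import Relation.Binary.PropositionalEquality
  open import Relation.Nullary.Decidable using (Dec; yes; no; does; dec-true; _×-dec_)
  open import Relation.Nullary.Negation using (contradiction)

  import Algebra.Properties.CommutativeMonoid.Sum ℕ.+-0-commutativeMonoid as ∑ℕ
  import Algebra.Properties.CommutativeMonoid.Sum +-0-commutativeMonoid as ∑ℚ
  open import Algebra.Properties.Semiring.Sum (CommutativeRing.semiring +-*-commutativeRing)
    using (*-distribʳ-sum)

  -- The 0 is a default; it is never reached for the tiers of an edge, as the last tier contains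
  -- every edge.
  first : ∀ {k} → (Fin k → Bool) → (Fin k → ℕ) → ℕ
  first {zero}  t r = 0
  first {suc k} t r = if t zero then r zero else first (t ∘ suc) (r ∘ suc)

  first-spec : ∀ {k} (t : Fin k → Bool) (r : Fin k → ℕ) j → t j ≡ true →
               ∃[ i ] t i ≡ true × first t r ≡ r i × i Fin.≤ j
  first-spec {suc k} t r j tj with t zero in t₀
  ... | true = zero , t₀ , refl , ℕ.z≤n
  first-spec {suc k} t r zero    tj | false with () ← trans (sym t₀) tj
  first-spec {suc k} t r (suc j) tj | false with first-spec (t ∘ suc) (r ∘ suc) j tj
  ... | i , ti , eq , i≤j = suc i , ti , eq , ℕ.s≤s i≤j

  xor-true : ∀ {p q} → p xor q ≡ true → p ≢ q
  xor-true {false} {true}  _ ()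
  xor-true {true}  {false} _ ()

  xor-false : ∀ {p q} → p xor q ≡ false → p ≡ q
  xor-false {false} {false} _ = refl
  xor-false {true}  {true}  _ = refl

  module Reduction {k : ℕ} (I : Instance (suc k)) where
    open Instance I

    u v : Fin m → Fin n
    u e = proj₁ (ends e)
    v e = proj₂ (ends e)

    member : Fin m → Fin (suc k) → Bool
    member e i = lookup (T i) e

    req : Fin m → ℕ
    req e = first (member e) q

    req-attained : ∀ e → ∃[ i ] member e i ≡ true × req e ≡ q i
    req-attained e with first-spec (member e) q (Fin.fromℕ k)
                          (trans (cong (λ A → lookup A e) (T-last (Fin.fromℕ k) (cong suc (Fin.toℕ-fromℕ k))))
                               (lookup-replicate e true))
    ... | i , ti , eq , _ = i , ti , eq

    req≤ : ∀ e j → member e j ≡ true → req e ℕ.≤ q j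
    req≤ e j tj with first-spec (member e) q j tj
    ... | i , _ , eq , i≤j = ℕ.≤-trans (ℕ.≤-reflexive eq) (q-mono i≤j)

    w : Fin m → ℚ
    w e = c e * ι (req e)

    w-nonNeg : ∀ e → 0ℚ ≤ w e
    w-nonNeg e = *-nonNeg (c-nonNeg e) (ι-nonNeg (req e))

    open Kruskal u v w w-nonNeg public

    cost-ι : ∀ x → cost I x ≡ ∑ℚ.sum λ e → c e * ι (x e)
    cost-ι x = ∑ℚ.sum-cong-≗ λ e → cong (c e *_) (/1≡ι (x e))

    cost-zero : ∀ {x : Solution I} → (∀ e → x e ≡ 0) → cost I x ≡ 0ℚ
    cost-zero {x} x≡0 = trans (cost-ι x) (∑-zero λ e →
      trans (cong (λ j → c e * ι j) (x≡0 e)) (trans (cong (c e *_) ι-0) (*-zeroʳ (c e))))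

    cost-nonNeg : ∀ x → 0ℚ ≤ cost I x
    cost-nonNeg x = subst (0ℚ ≤_) (sym (cost-ι x)) (∑-nonNeg λ e → *-nonNeg (c-nonNeg e) (ι-nonNeg (x e)))

    twice : ∀ p → p + p ≡ ℤ.+ 2 / 1 * p
    twice p = solve 1 (λ p → p :+ p := con (ℤ.+ 2 / 1) :* p) refl p
      where open +-*-Solver

    zero-approximates : ∀ {x} → q zero ≡ 0 → (∀ e → x e ≡ 0) → Approximate I (ℤ.+ 2 / 1) x
    zero-approximates {x} q₀≡0 x≡0 =
      (λ _ _ _ → zero , ℕ.≤-trans (ℕ.≤-reflexive q₀≡0) ℕ.z≤n) ,
      (λ y _ → ≤-trans (≤-reflexive (cost-zero x≡0))
        (subst (0ℚ ≤_) (twice (cost I y)) (+-nonNeg (cost-nonNeg y) (cost-nonNeg y))))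

    -- `spans` is connectivity in terms of cuts: a side crossed by no fully bought edge is a union
    -- of label classes. That is the form in which feasibility needs it.
    record Forest (lab : Labels) (x : Solution I) : Set where
      field
        rooted : Rooted lab
        dual   : Dual lab (cost I x)
        spans  : ∀ (R : Fin n → Bool) → (∀ e → req e ℕ.≤ x e → R (u e) ≡ R (v e)) →
                 ∀ a → R a ≡ R (lab a)

    forest-init : ∀ {x} → (∀ e → x e ≡ 0) → Forest (λ a → a) x
    forest-init x≡0 = record
      { rooted = λ _ → refl
      ; dual   = subst (Dual _) (sym (cost-zero x≡0)) dual-init
      ; spans  = λ _ _ _ → refl
      }

    -- Memory determines a solution only pointwise; without function extensionality the invariant
    -- has to be transported termwise.
    forest-resp : ∀ {lab x x′} → (∀ e → x e ≡ x′ e) → Forest lab x → Forest lab x′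
    forest-resp {x = x} {x′} x≡x′ forest = record
      { rooted = rooted
      ; dual   = subst (Dual _) (∑ℚ.sum-cong-≗ λ e → cong (λ j → c e * (ℤ.+ j / 1)) (x≡x′ e)) dual
      ; spans  = λ R uncrossed → spans R λ e le → uncrossed e (subst (req e ℕ.≤_) (x≡x′ e) le)
      }
      where open Forest forest

    forest-step : ∀ {lab x x′ e₀} → crossing lab e₀ ≡ true →
                  (∀ e → crossing lab e ≡ true → w e₀ ≤ w e) →
                  x′ e₀ ≡ req e₀ → (∀ e → e ≢ e₀ → x′ e ≡ x e) →
                  Forest lab x → Forest (merge lab (lab (u e₀)) (lab (v e₀))) x′
    forest-step {lab} {x} {x′} {e₀} cross₀ minimal x′₀ x′≡x forest = record
      { rooted = merge-rooted rooted cross₀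
      ; dual   = dual-step rooted cross₀ minimal cost≤ dual
      ; spans  = spans′
      }
      where
      open Forest forest
      cost≤ : cost I x′ ≤ cost I x + w e₀
      cost≤ = begin
        cost I x′                                                       ≡⟨ cost-ι x′ ⟩
        ∑ℚ.sum (λ e → c e * ι (x′ e))                                   ≤⟨ ∑-mono (λ e → term e (e₀ ≟ e)) ⟩
        ∑ℚ.sum (λ e → c e * ι (x e) + on (does (e₀ ≟ e)) (w e₀))
          ≡⟨ ∑ℚ.∑-distrib-+ (λ e → c e * ι (x e)) _ ⟩
        ∑ℚ.sum (λ e → c e * ι (x e)) + ∑ℚ.sum (λ e → on (does (e₀ ≟ e)) (w e₀))
          ≡⟨ cong₂ _+_ (sym (cost-ι x)) (∑-select e₀ (w e₀)) ⟩
        cost I x + w e₀                                                 ∎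
        where
        open ≤-Reasoning
        term : ∀ e (d : Dec (e₀ ≡ e)) → c e * ι (x′ e) ≤ c e * ι (x e) + on (does d) (w e₀)
        -- The old value of x at e₀ is overwritten; its cost is nonnegative, so an inequality
        -- suffices.
        term e (yes refl) = ≤-trans (≤-reflexive (trans (cong (λ j → c e * ι j) x′₀) (sym (+-identityˡ (w e)))))
                                    (+-monoˡ-≤ (w e) (*-nonNeg (c-nonNeg e) (ι-nonNeg (x e))))
        term e (no e₀≢e)  = ≤-reflexive (trans (cong (λ j → c e * ι j) (x′≡x e (e₀≢e ∘ sym)))
                                              (sym (+-identityʳ (c e * ι (x e)))))
      uncrossed-before : ∀ {R : Fin n → Bool} → (∀ e → req e ℕ.≤ x′ e → R (u e) ≡ R (v e)) →
                         ∀ e → Dec (e ≡ e₀) → req e ℕ.≤ x e → R (u e) ≡ R (v e)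
      uncrossed-before uncrossed e (yes refl) _  = uncrossed e (ℕ.≤-reflexive (sym x′₀))
      uncrossed-before uncrossed e (no e≢e₀)  le = uncrossed e (ℕ.≤-trans le (ℕ.≤-reflexive (sym (x′≡x e e≢e₀))))
      spans′ : ∀ (R : Fin n → Bool) → (∀ e → req e ℕ.≤ x′ e → R (u e) ≡ R (v e)) →
               ∀ a → R a ≡ R (merge lab (lab (u e₀)) (lab (v e₀)) a)
      spans′ R uncrossed a = go (lab a ≟ lab (v e₀))
        where
        old : ∀ a → R a ≡ R (lab a)
        old = spans R λ e → uncrossed-before {R} uncrossed e (e ≟ e₀)
        go : (d : Dec (lab a ≡ lab (v e₀))) → R a ≡ R (if does d then lab (u e₀) else lab a)
        go (no _)  = old a
        -- A relabelled vertex is linked to the class of u e₀ through v e₀ and the new edge, which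
        -- is now fully bought.
        go (yes p) = begin
          R a               ≡⟨ old a ⟩
          R (lab a)         ≡⟨ cong R p ⟩
          R (lab (v e₀))    ≡⟨ old (v e₀) ⟨
          R (v e₀)          ≡⟨ uncrossed e₀ (ℕ.≤-reflexive (sym x′₀)) ⟨
          R (u e₀)          ≡⟨ old (u e₀) ⟩
          R (lab (u e₀))    ∎
          where open ≡-Reasoning

    lookup-δ∩T : ∀ R e i → lookup (δ I R ∩ T i) e ≡ (lookup R (u e) xor lookup R (v e)) ∧ member e i
    lookup-δ∩T R e i = trans (lookup-zipWith _∧_ e (δ I R) (T i))
                             (cong (_∧ member e i) (lookup∘tabulate (λ e → lookup R (u e) xor lookup R (v e)) e))

    -- Passes from subsets, in which feasibility is stated, to Boolean sides, in which label classes
    -- and fractional covers are written.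
    feasible-cut : ∀ {y} → Feasible I y → ∀ (R : Fin n → Bool) {a b} → R a ≡ true → R b ≡ false →
                   ∃[ i ] q i ℕ.≤ ∑ℕ.sum λ e → if (R (u e) xor R (v e)) ∧ member e i then y e else 0
    feasible-cut {y} feas R {a} {b} Ra Rb
      with feas (tabulate R) (a , lookup⇒[]= a (tabulate R) (trans (lookup∘tabulate R a) Ra)) not-all
      where
      not-all : tabulate R ≢ ⊤
      not-all eq with () ← trans (sym Rb) (trans (sym (lookup∘tabulate R b))
        (trans (cong (λ A → lookup A b) eq) (lookup-replicate b true)))
    ... | i , q≤ = i , ℕ.≤-trans q≤ (ℕ.≤-reflexive (∑ℕ.sum-cong-≗ λ e → cong (λ t → if t then y e else 0)
            (trans (lookup-δ∩T (tabulate R) e i)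
              (cong₂ (λ s t → (s xor t) ∧ member e i) (lookup∘tabulate R (u e)) (lookup∘tabulate R (v e))))))

    module _ (1≤q₀ : 1 ℕ.≤ q zero) where

      1≤q : ∀ i → 1 ℕ.≤ q i
      1≤q i = ℕ.≤-trans 1≤q₀ (q-mono ℕ.z≤n)

      1≤req : ∀ e → 1 ℕ.≤ req e
      1≤req e with req-attained e
      ... | i , _ , eq = ℕ.≤-trans (1≤q i) (ℕ.≤-reflexive (sym eq))

      share : Solution I → Fin m → ℚ
      share y e = ι (y e) * inv (req e)

      share-nonNeg : ∀ y e → 0ℚ ≤ share y e
      share-nonNeg y e = *-nonNeg (ι-nonNeg (y e)) (inv-nonNeg (req e))

      w*share : ∀ y e → w e * share y e ≡ c e * ι (y e)
      w*share y e = begin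
        c e * ι r * (ι (y e) * inv r)
          ≡⟨ solve 4 (λ c r y s → c :* r :* (y :* s) := c :* y :* (r :* s)) refl (c e) (ι r) (ι (y e)) (inv r) ⟩
        c e * ι (y e) * (ι r * inv r)      ≡⟨ cong (c e * ι (y e) *_) (ι*inv (1≤req e)) ⟩
        c e * ι (y e) * 1ℚ                 ≡⟨ *-identityʳ (c e * ι (y e)) ⟩
        c e * ι (y e)                      ∎
        where
        open ≡-Reasoning
        open +-*-Solver
        r = req e

      -- Edges of Tᵢ have requirement at most qᵢ, so a cut that is satisfied in
      -- tier i has total share at least 1.
      share-cover : ∀ {y} → Feasible I y → FractionalCover (share y)
      share-cover {y} feas R Ra Rb with feasible-cut feas R Ra Rb
      ... | i , q≤ = begin
        1ℚ                                        ≡⟨ ι*inv (1≤q i) ⟨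
        ι (q i) * inv (q i)                       ≤⟨ *-monoʳ (inv-nonNeg (q i)) (ι-mono q≤) ⟩
        ι (∑ℕ.sum part) * inv (q i)               ≡⟨ cong (_* inv (q i)) (ι-∑ part) ⟩
        ∑ℚ.sum (λ e → ι (part e)) * inv (q i)     ≡⟨ *-distribʳ-sum (inv (q i)) (λ e → ι (part e)) ⟩
        ∑ℚ.sum (λ e → ι (part e) * inv (q i))     ≤⟨ ∑-mono term ⟩
        ∑ℚ.sum (λ e → on (R (u e) xor R (v e)) (share y e)) ∎
        where
        open ≤-Reasoning
        part : Fin m → ℕ
        part e = if (R (u e) xor R (v e)) ∧ member e i then y e else 0
        zero-part : ι 0 * inv (q i) ≡ 0ℚ
        zero-part = trans (cong (_* inv (q i)) ι-0) (*-zeroˡ (inv (q i)))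
        term : ∀ e → ι (part e) * inv (q i) ≤ on (R (u e) xor R (v e)) (share y e)
        term e with R (u e) xor R (v e) | member e i in eq
        ... | false | _     = ≤-reflexive zero-part
        ... | true  | false = ≤-trans (≤-reflexive zero-part) (share-nonNeg y e)
        ... | true  | true  = *-monoˡ (ι-nonNeg (y e)) (inv-antitone (1≤req e) (req≤ e i eq))

      forest-approximates : ∀ {lab x} → Forest lab x → (∀ e → crossing lab e ≡ false) →
                            FeasibleInstance I → Approximate I (ℤ.+ 2 / 1) x
      forest-approximates {lab} {x} forest none (z , z-feas) = feasible , cheap
        where
        open Forest forest
        cheap : ∀ y → Feasible I y → cost I x ≤ ℤ.+ 2 / 1 * cost I y
        cheap y feas = begin
          cost I x              ≤⟨ dual-final dual (share y) (share-nonNeg y) (share-cover feas) ⟩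
          W + W                 ≡⟨ cong (λ p → p + p) (trans (∑ℚ.sum-cong-≗ (w*share y)) (sym (cost-ι y))) ⟩
          cost I y + cost I y   ≡⟨ twice (cost I y) ⟩
          ℤ.+ 2 / 1 * cost I y  ∎
          where
          open ≤-Reasoning
          W = ∑ℚ.sum λ e → w e * share y e

        lab-ends : ∀ e → lab (u e) ≡ lab (v e)
        lab-ends e with lab (u e) ≟ lab (v e) | none e
        ... | yes p | _ = p

        -- Otherwise the class of a would be a cut without edges, on which the feasible z would
        -- still have to reach some q i ≥ 1.
        lab-const : ∀ a b → lab a ≡ lab b
        lab-const a b with lab b ≟ lab a in eq
        ... | yes p = sym p
        ... | no _ with feasible-cut z-feas (λ c → does (lab c ≟ lab a))
                              (dec-true (lab a ≟ lab a) refl) (cong does eq)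
        ...   | i , q≤ = contradiction
          (ℕ.≤-trans (1≤q i) (ℕ.≤-trans q≤ (ℕ.≤-reflexive (trans (∑ℕ.sum-cong-≗ uncut) (∑ℕ.sum-replicate-zero m))))) λ ()
          where
          uncut : ∀ e → (if (does (lab (u e) ≟ lab a) xor does (lab (v e) ≟ lab a)) ∧ member e i then z e else 0) ≡ 0
          uncut e rewrite lab-ends e | 𝔹.xor-same (does (lab (v e) ≟ lab a)) = refl

        -- If a fully bought edge e crosses R, its copies alone meet the demand of tier ℓ(e). If
        -- none does, R is a union of classes; there is only one class, so R would be all of V.
        feasible : Feasible I x
        feasible R (a , a∈R) R≢⊤
          with any? (λ e → ((lookup R (u e) xor lookup R (v e)) 𝔹.≟ true) ×-dec (req e ℕ.≤? x e))
        ... | yes (e , cut , full) with req-attained e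
        ...   | i , mem , eq = i , (begin
          q i                         ≡⟨ eq ⟨
          req e                       ≤⟨ full ⟩
          x e
            ≡⟨ cong (λ t → if t then x e else 0) (trans (lookup-δ∩T R e i) (cong₂ _∧_ cut mem)) ⟨
          (if lookup (δ I R ∩ T i) e then x e else 0)
            ≤⟨ ∑ℕ-term (λ e → if lookup (δ I R ∩ T i) e then x e else 0) e ⟩
          total I x (δ I R ∩ T i)     ∎)
          where open ℕ.≤-Reasoning
        feasible R (a , a∈R) R≢⊤ | no none-cut = contradiction R≡⊤ R≢⊤
          where
          uncrossed : ∀ e → req e ℕ.≤ x e → lookup R (u e) ≡ lookup R (v e)
          uncrossed e full with lookup R (u e) xor lookup R (v e) in eq
          ... | false = xor-false eq
          ... | true  = contradiction (e , eq , full) none-cut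
          all-in : ∀ b → lookup R b ≡ true
          all-in b = begin
            lookup R b          ≡⟨ spans (lookup R) uncrossed b ⟩
            lookup R (lab b)    ≡⟨ cong (lookup R) (lab-const b a) ⟩
            lookup R (lab a)    ≡⟨ spans (lookup R) uncrossed a ⟨
            lookup R a          ≡⟨ []=⇒lookup a∈R ⟩
            true                ∎
            where open ≡-Reasoning
          R≡⊤ : R ≡ ⊤
          R≡⊤ = begin
            R                             ≡⟨ tabulate∘lookup R ⟨
            tabulate (lookup R)
              ≡⟨ tabulate-cong (λ b → trans (all-in b) (sym (lookup-replicate b true))) ⟩
            tabulate (lookup (⊤ {n = n})) ≡⟨ tabulate∘lookup ⊤ ⟩
            ⊤                             ∎
            where open ≡-Reasoning

-- The program

module Algorithm where

  open LogarithmicCost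
  open FractionalCuts using (ι; toℚᵘ-ι; ∑ℕ-≤)
  open TierReduction
  open import Data.Bool.Base using (Bool; true; false; if_then_else_; not)
  open import Data.Fin.Base as Fin using (Fin; zero; suc; toℕ; fromℕ<)
  open import Data.Fin.Properties as Fin using (toℕ-injective; toℕ<n; toℕ-fromℕ<)
  open import Data.Integer.Base as ℤ using (∣_∣)
  import Data.Integer.Properties as ℤ
  open import Data.List.Base as List using (List; []; _∷_; length)
  open import Data.List.Properties using (length-tabulate)
  open import Data.Nat.Base hiding (_/_)
  open import Data.Nat.ListAction using (sum)
  open import Data.Nat.Properties
  open import Data.Product.Base using (∃-syntax; _×_; _,_; proj₁; proj₂)
  open import Data.Rational.Base as ℚ using (ℚ; 0ℚ; mkℚ; ↥_; ↧ₙ_; nonNegative)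
  import Data.Rational.Properties as ℚ
  open import Data.Rational.Unnormalised.Base as ℚᵘ using (mkℚᵘ; *≤*)
  import Data.Rational.Unnormalised.Properties as ℚᵘ
  open import Data.Sum.Base using (_⊎_; inj₁; inj₂)
  open import Data.Vec.Base using (lookup)
  open import Function.Base using (_∘_)
  open import Relation.Binary.PropositionalEquality
  open import Relation.Nullary.Decidable using (dec-true; dec-false)
  open import Relation.Nullary.Negation using (contradiction)

  -- The machine has no fractions, so weights are compared after clearing denominators.
  -- Nonnegativity makes the absolute value of a numerator the numerator itself.
  cross-multiplied-≤ : ∀ {p p′} r r′ → 0ℚ ℚ.≤ p → 0ℚ ℚ.≤ p′ →
                       ∣ ↥ p ∣ * r * ↧ₙ p′ ≤ ∣ ↥ p′ ∣ * r′ * ↧ₙ p → p ℚ.* ι r ℚ.≤ p′ ℚ.* ι r′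
  cross-multiplied-≤ {mkℚ ℤ.-[1+ _ ] _ _} r r′ 0≤p 0≤p′ _ with () ← nonNegative 0≤p
  cross-multiplied-≤ {mkℚ (ℤ.+ _) _ _} {mkℚ ℤ.-[1+ _ ] _ _} r r′ 0≤p 0≤p′ _ with () ← nonNegative 0≤p′
  cross-multiplied-≤ {p@(mkℚ (ℤ.+ a) d _)} {p′@(mkℚ (ℤ.+ a′) d′ _)} r r′ _ _ le =
    ℚ.toℚᵘ-cancel-≤ (ℚᵘ.≤-respˡ-≃ (ℚᵘ.≃-sym (product p r)) (ℚᵘ.≤-respʳ-≃ (ℚᵘ.≃-sym (product p′ r′))
      (*≤* (subst₂ ℤ._≤_ (side a r d′) (side a′ r′ d) (ℤ.+≤+ le)))))
    where
    product : ∀ p r → ℚ.toℚᵘ (p ℚ.* ι r) ℚᵘ.≃ ℚ.toℚᵘ p ℚᵘ.* mkℚᵘ (ℤ.+ r) 0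
    product p r = ℚᵘ.≃-trans (ℚ.toℚᵘ-homo-* p (ι r)) (ℚᵘ.*-congˡ {ℚ.toℚᵘ p} (toℚᵘ-ι r))
    side : ∀ a r d → ℤ.+ (a * r * suc d) ≡ ℤ.+ a ℤ.* ℤ.+ r ℤ.* ℤ.+ (suc d * 1)
    side a r d = trans (ℤ.pos-* (a * r) (suc d)) (cong₂ ℤ._*_ (ℤ.pos-* a r) (cong ℤ.+_ (sym (*-identityʳ (suc d)))))

  -- Reading the input

  entry-tabulate : ∀ {n} (f : Fin n → ℕ) i → entry (List.tabulate f) (toℕ i) ≡ f i
  entry-tabulate f zero    = refl
  entry-tabulate f (suc i) = entry-tabulate (f ∘ suc) i

  load-tabulate : ∀ {n} (f : Fin n → List ℕ) i j → load (List.tabulate f) (suc (toℕ i)) j ≡ entry (f i) j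
  load-tabulate f zero    j = refl
  load-tabulate f (suc i) j = load-tabulate (f ∘ suc) i j

  length≤bits : ∀ l → length l ≤ sum (List.map bits l)
  length≤bits []      = z≤n
  length≤bits (v ∷ l) = +-mono-≤ (s≤s (z≤n {n = _})) (length≤bits l)

  tabulate≤bits : ∀ {n} (f : Fin n → ℕ) → n ≤ sum (List.map bits (List.tabulate f))
  tabulate≤bits f = ≤-trans (≤-reflexive (sym (length-tabulate f))) (length≤bits (List.tabulate f))

  entry-bits : ∀ {s} l i → 1 ≤ s → sum (List.map bits l) ≤ s → bits (entry l i) ≤ s
  entry-bits []      i       1≤s _ = 1≤s
  entry-bits (v ∷ l) zero    1≤s le = m+n≤o⇒m≤o (bits v) le
  entry-bits (v ∷ l) (suc i) 1≤s le = entry-bits l i 1≤s (m+n≤o⇒n≤o (bits v) le)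

  load-bits : ∀ {s} w a i → 1 ≤ s → inputSize w ≤ s → bits (load w a i) ≤ s
  load-bits w       zero          i 1≤s _  = 1≤s
  load-bits []      (suc a)       i 1≤s _  = 1≤s
  load-bits (l ∷ w) (suc zero)    i 1≤s le = entry-bits l i 1≤s (m+n≤o⇒m≤o _ le)
  load-bits (l ∷ w) (suc (suc a)) i 1≤s le = load-bits w (suc a) i 1≤s (m+n≤o⇒n≤o (sum (List.map bits l)) le)

  -- Array 1 holds n and m; its further cells serve as scalar variables.
  -- Array 2 initially holds 0, …, n − 1 and serves as the labels.
  scalar : ℕ → Exp
  scalar j = 1 ! lit j

  #n #m best counter keep drop : Exp
  #n      = scalar 0
  #m      = scalar 1
  best    = scalar 2
  counter = scalar 3
  keep    = scalar 4
  drop    = scalar 5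

  next : Program
  next = 1 ! lit 3 := counter ⊕ lit 1

  -- One of the truncated differences is 0, so the sum is the distance of e and f.
  differ : Exp → Exp → Exp
  differ e f = (e ⊖ f) ⊕ (f ⊖ e)

  -- Branch-free selection b q + (1 - b) rest with b the membership bit. The recursion runs when the
  -- program is written, because tier arrays can only be named by literals.
  firstExp : (a i k : ℕ) → Exp → Exp
  firstExp a i zero    e = lit 0
  firstExp a i (suc k) e = (a ! e ⊛ 3 ! lit i) ⊕ ((lit 1 ⊖ a ! e) ⊛ firstExp (suc a) (suc i) k e)

  module Code (k : ℕ) where

    reqExp : Exp → Exp
    reqExp e = firstExp 8 0 k e

    -- Truncated and cross-multiplied: nonzero exactly when e weighs more than f.
    excess : Exp → Exp → Exp
    excess e f = (6 ! e ⊛ reqExp e ⊛ 7 ! f) ⊖ (6 ! f ⊛ reqExp f ⊛ 7 ! e)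

    chosen : Exp
    chosen = best ⊖ lit 1

    -- Product as conjunction, sum as disjunction: the current edge crosses, and either no edge has
    -- been found yet or it is cheaper than the one found.
    improves : Exp
    improves = differ (2 ! (4 ! counter)) (2 ! (5 ! counter)) ⊛ ((lit 1 ⊖ best) ⊕ excess chosen counter)

    scan-body scan search relabel-body relabel join round main : Program
    scan-body = (if improves then 1 ! lit 2 := counter ⊕ lit 1 else′ skip) ⨾ next
    scan = while #m ⊖ counter run scan-body
    search = 1 ! lit 2 := lit 0 ⨾ 1 ! lit 3 := lit 0 ⨾ scan
    relabel-body = (if differ (2 ! counter) drop then skip else′ (2 ! counter := keep)) ⨾ next
    relabel = while #n ⊖ counter run relabel-body
    -- Both labels are copied to scalars first, since relabelling overwrites the array they are read
    -- from.
    join = 0 ! chosen := reqExp chosen ⨾ 1 ! lit 4 := 2 ! (4 ! chosen) ⨾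
           1 ! lit 5 := 2 ! (5 ! chosen) ⨾ 1 ! lit 3 := lit 0 ⨾ relabel
    round = search ⨾ (if best then join else′ skip)
    -- The 1 in cell 2 is a dummy that opens the loop; the first search overwrites it.
    main = if 3 ! lit 0 then (1 ! lit 2 := lit 1 ⨾ while best run round) else′ skip

  ⟦firstExp⟧ : ∀ {k} a i x {M} (t : Fin k → Bool) (r : Fin k → ℕ) →
               (∀ j → M (toℕ j + a) (⟦ x ⟧ M) ≡ (if t j then 1 else 0)) →
               (∀ j → M 3 (toℕ j + i) ≡ r j) → ⟦ firstExp a i k x ⟧ M ≡ first t r
  ⟦firstExp⟧ {zero}  a i x t r _ _ = refl
  ⟦firstExp⟧ {suc k} a i x {M} t r ts rs
    rewrite ts zero | rs zero
          | ⟦firstExp⟧ (suc a) (suc i) x {M} (t ∘ suc) (r ∘ suc)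
              (λ j → trans (cong (λ b → M b (⟦ x ⟧ M)) (+-suc (toℕ j) a)) (ts (suc j)))
              (λ j → trans (cong (M 3) (+-suc (toℕ j) i)) (rs (suc j)))
    with t zero
  ... | true  = trans (+-identityʳ _) (+-identityʳ _)
  ... | false = +-identityʳ _

  distance : ℕ → ℕ → ℕ
  distance i j = (i ∸ j) + (j ∸ i)

  distance-zero : ∀ {i j} → distance i j ≡ 0 → i ≡ j
  distance-zero {i} {j} eq = ≤-antisym (m∸n≡0⇒m≤n (m+n≡0⇒m≡0 (i ∸ j) eq)) (m∸n≡0⇒m≤n (m+n≡0⇒n≡0 (i ∸ j) eq))

  distance-refl : ∀ i → distance i i ≡ 0
  distance-refl i = cong₂ _+_ (n∸n≡0 i) (n∸n≡0 i)

  <suc-cases : ∀ {i j} → i < suc j → i < j ⊎ i ≡ j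
  <suc-cases (s≤s i≤j) = m≤n⇒m<n∨m≡n i≤j

  record Encodes {k : ℕ} (I : Instance k) (M : Memory) : Set where
    open Instance I
    field
      zeros     : ∀ i → M 0 i ≡ 0
      at-n      : M 1 0 ≡ n
      at-m      : M 1 1 ≡ m
      at-vertex : ∀ (a : Fin n) → M 2 (toℕ a) ≡ toℕ a
      at-q      : ∀ i → M 3 (toℕ i) ≡ q i
      at-u      : ∀ e → M 4 (toℕ e) ≡ toℕ (proj₁ (ends e))
      at-v      : ∀ e → M 5 (toℕ e) ≡ toℕ (proj₂ (ends e))
      at-num    : ∀ e → M 6 (toℕ e) ≡ ∣ ↥ c e ∣
      at-den    : ∀ e → M 7 (toℕ e) ≡ ↧ₙ c e
      at-T      : ∀ i e → M (8 + toℕ i) (toℕ e) ≡ (if lookup (T i) e then 1 else 0)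

  load-encodes : ∀ {k} (I : Instance k) → Encodes I (load (encode I))
  load-encodes I = record
    { zeros     = λ _ → refl
    ; at-n      = refl
    ; at-m      = refl
    ; at-vertex = entry-tabulate toℕ
    ; at-q      = entry-tabulate q
    ; at-u      = entry-tabulate (λ e → toℕ (proj₁ (ends e)))
    ; at-v      = entry-tabulate (λ e → toℕ (proj₂ (ends e)))
    ; at-num    = entry-tabulate (λ e → ∣ ↥ c e ∣)
    ; at-den    = entry-tabulate (λ e → ↧ₙ c e)
    ; at-T      = λ i e → trans (load-tabulate (λ i → List.tabulate λ e → if lookup (T i) e then 1 else 0) i (toℕ e))
                                (entry-tabulate (λ e → if lookup (T i) e then 1 else 0) e)
    }
    where open Instance I

  module _ {k : ℕ} (I : Instance k) where
    open Instance I

    -- Strict because the numbers n and m are written besides the list of vertices; the outer loop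
    -- is allowed n + 1 rounds.
    n<inputSize : n < inputSize (encode I)
    n<inputSize = +-mono-≤ {1} {bits n + (bits m + 0)} (s≤s z≤n) (≤-trans (tabulate≤bits (toℕ {n})) (m≤m+n _ _))

    m≤inputSize : m ≤ inputSize (encode I)
    m≤inputSize = m≤n⇒m≤o+n (bits n + (bits m + 0)) (m≤n⇒m≤o+n (sum (List.map bits (List.tabulate {n = n} toℕ)))
      (m≤n⇒m≤o+n (sum (List.map bits (List.tabulate q)))
        (≤-trans (tabulate≤bits (λ e → toℕ (proj₁ (ends e)))) (m≤m+n _ _))))

  -- Correctness and termination of the program

  module Verification
    {k : ℕ} (I : Instance (suc k)) (s : ℕ) (1≤s : 1 ≤ s) (n<s : Instance.n I < s) (m≤s : Instance.m I ≤ s)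
    (M₀ : Memory) (M₀-bounded : Timed.Bounded s 1≤s M₀) (encodes : Encodes I M₀) where

    open Instance I
    open Reduction I
    open Code (suc k)
    open Timed s 1≤s
    open Encodes encodes

    record Base (M : Memory) : Set where
      field
        size-n : M 1 0 ≡ n
        size-m : M 1 1 ≡ m
        frozen : ∀ a i → M (3 + a) i ≡ M₀ (3 + a) i

    record Core (lab : Labels) (x : Solution I) (M : Memory) : Set where
      field
        base   : Base M
        labels : ∀ a → M 2 (toℕ a) ≡ toℕ (lab a)
        chosen-copies : ∀ e → M 0 (toℕ e) ≡ x e
      open Base base public

    -- With the index in the form 2 + j, `update` reduces at every cell that `Base` mentions, and
    -- the old proofs apply unchanged.
    base-scalar : ∀ {M} j z → Base M → Base (update M 1 (2 + j) z)
    base-scalar j z b = record { size-n = size-n ; size-m = size-m ; frozen = frozen }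
      where open Base b

    core-scalar : ∀ {lab x M} j z → Core lab x M → Core lab x (update M 1 (2 + j) z)
    core-scalar j z core = record { base = base-scalar j z base ; labels = labels ; chosen-copies = chosen-copies }
      where open Core core

    module _ {M : Memory} (b : Base M) (x : Exp) (e : Fin m) (at : ⟦ x ⟧ M ≡ toℕ e) where
      open Base b

      read-u : ⟦ 4 ! x ⟧ M ≡ toℕ (u e)
      read-u = trans (cong (M 4) at) (trans (frozen 1 (toℕ e)) (at-u e))

      read-v : ⟦ 5 ! x ⟧ M ≡ toℕ (v e)
      read-v = trans (cong (M 5) at) (trans (frozen 2 (toℕ e)) (at-v e))

      read-num : ⟦ 6 ! x ⟧ M ≡ ∣ ↥ c e ∣
      read-num = trans (cong (M 6) at) (trans (frozen 3 (toℕ e)) (at-num e))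

      read-den : ⟦ 7 ! x ⟧ M ≡ ↧ₙ c e
      read-den = trans (cong (M 7) at) (trans (frozen 4 (toℕ e)) (at-den e))

      read-req : ⟦ reqExp x ⟧ M ≡ req e
      read-req = ⟦firstExp⟧ 8 0 x {M} (member e) q
        (λ j → trans (cong₂ M (+-comm (toℕ j) 8) at) (trans (frozen (5 + toℕ j) (toℕ e)) (at-T j e)))
        (λ j → trans (cong (M 3) (+-identityʳ (toℕ j))) (trans (frozen 0 (toℕ j)) (at-q j)))

    read-excess : ∀ {M} → Base M → ∀ x e y f → ⟦ x ⟧ M ≡ toℕ e → ⟦ y ⟧ M ≡ toℕ f →
                  ⟦ excess x y ⟧ M ≡ ∣ ↥ c e ∣ * req e * ↧ₙ c f ∸ ∣ ↥ c f ∣ * req f * ↧ₙ c e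
    read-excess b x e y f at-e at-f = cong₂ _∸_
      (cong₂ _*_ (cong₂ _*_ (read-num b x e at-e) (read-req b x e at-e)) (read-den b y f at-f))
      (cong₂ _*_ (cong₂ _*_ (read-num b y f at-f) (read-req b y f at-f)) (read-den b x e at-e))

    excess-zero : ∀ {M} → Base M → ∀ x e y f → ⟦ x ⟧ M ≡ toℕ e → ⟦ y ⟧ M ≡ toℕ f →
                  ⟦ excess x y ⟧ M ≡ 0 → w e ℚ.≤ w f
    excess-zero b x e y f at-e at-f eq = cross-multiplied-≤ (req e) (req f) (c-nonNeg e) (c-nonNeg f)
      (m∸n≡0⇒m≤n (trans (sym (read-excess b x e y f at-e at-f)) eq))

    excess-nonZero : ∀ {M} → Base M → ∀ x e y f → ⟦ x ⟧ M ≡ toℕ e → ⟦ y ⟧ M ≡ toℕ f →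
                     ⟦ excess x y ⟧ M ≢ 0 → w f ℚ.≤ w e
    excess-nonZero b x e y f at-e at-f neq = cross-multiplied-≤ (req f) (req e) (c-nonNeg f) (c-nonNeg e)
      (≰⇒≥ λ le → neq (trans (read-excess b x e y f at-e at-f) (m≤n⇒m∸n≡0 le)))

    module _ {lab x M} (core : Core lab x M) (y : Exp) (e : Fin m) (at : ⟦ y ⟧ M ≡ toℕ e) where
      open Core core

      read-label-u : ⟦ 2 ! (4 ! y) ⟧ M ≡ toℕ (lab (u e))
      read-label-u = trans (cong (M 2) (read-u base y e at)) (labels (u e))

      read-label-v : ⟦ 2 ! (5 ! y) ⟧ M ≡ toℕ (lab (v e))
      read-label-v = trans (cong (M 2) (read-v base y e at)) (labels (v e))

      differ-zero : ⟦ differ (2 ! (4 ! y)) (2 ! (5 ! y)) ⟧ M ≡ 0 → crossing lab e ≡ false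
      differ-zero eq = cong not (dec-true (lab (u e) Fin.≟ lab (v e))
        (toℕ-injective (trans (sym read-label-u) (trans (distance-zero eq) read-label-v))))

      differ-nonZero : ⟦ differ (2 ! (4 ! y)) (2 ! (5 ! y)) ⟧ M ≢ 0 → crossing lab e ≡ true
      differ-nonZero neq = cong not (dec-false (lab (u e) Fin.≟ lab (v e))
        λ eq → neq (trans (cong₂ distance read-label-u read-label-v)
          (trans (cong (λ l → distance (toℕ l) (toℕ (lab (v e)))) eq) (distance-refl (toℕ (lab (v e)))))))

    -- Cell 2 is 0, or one more than the index of an edge.
    data Best (lab : Labels) (i : ℕ) (z : ℕ) : Set where
      none : z ≡ 0 → (∀ e → toℕ e < i → crossing lab e ≡ false) → Best lab i z
      some : ∀ e₀ → z ≡ suc (toℕ e₀) → crossing lab e₀ ≡ true →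
             (∀ e → toℕ e < i → crossing lab e ≡ true → w e₀ ℚ.≤ w e) → Best lab i z

    best-suc : ∀ {lab z} {e : Fin m} → Best lab (toℕ e) z → crossing lab e ≡ false → Best lab (suc (toℕ e)) z
    best-suc {lab} {e = e} (none eq no-cross) not-e = none eq λ f f< → go f (<suc-cases f<)
      where
      go : ∀ f → toℕ f < toℕ e ⊎ toℕ f ≡ toℕ e → crossing lab f ≡ false
      go f (inj₁ f<e) = no-cross f f<e
      go f (inj₂ f≡e) = trans (cong (crossing lab) (toℕ-injective f≡e)) not-e
    best-suc {lab} {e = e} (some e₀ eq cross₀ minimal) not-e = some e₀ eq cross₀ λ f f< → go f (<suc-cases f<)
      where
      go : ∀ f → toℕ f < toℕ e ⊎ toℕ f ≡ toℕ e → crossing lab f ≡ true → w e₀ ℚ.≤ w f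
      go f (inj₁ f<e) = minimal f f<e
      go f (inj₂ f≡e) cross with () ← trans (sym cross) (trans (cong (crossing lab) (toℕ-injective f≡e)) not-e)

    record Scan (lab : Labels) (x : Solution I) (i : ℕ) (M : Memory) : Set where
      field
        core       : Core lab x M
        at-counter : M 1 3 ≡ i
        found      : Best lab i (M 1 2)

    -- An incremented counter is still at most its limit N; the limits n and m are themselves input
    -- cells.
    suc-bits : ∀ {N i z} → bits N ≤ s → i < N → z ≡ i → bits (z + 1) ≤ s
    suc-bits {N} {i} N≤ i<N refl = ≤-trans (bits-mono (≤-trans (≤-reflexive (+-comm i 1)) i<N)) N≤

    m-bits : bits m ≤ s
    m-bits = subst (λ z → bits z ≤ s) at-m (cell M₀-bounded 1 1)

    n-bits : bits n ≤ s
    n-bits = subst (λ z → bits z ≤ s) at-n (cell M₀-bounded 1 0)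

    ends-differ : Memory → ℕ
    ends-differ M = ⟦ differ (2 ! (4 ! counter)) (2 ! (5 ! counter)) ⟧ M

    improved : ∀ {lab x M} {e : Fin m} → Scan lab x (toℕ e) M → ⟦ improves ⟧ M ≢ 0 →
               Best lab (suc (toℕ e)) (suc (toℕ e))
    improved {lab} {x} {M} {e} scan neq = some e refl cross-e λ f f< → go f (<suc-cases f<) found
      where
      open Scan scan
      cross-e : crossing lab e ≡ true
      cross-e = differ-nonZero core counter e at-counter λ eq →
        neq (cong (_* ⟦ (lit 1 ⊖ best) ⊕ excess chosen counter ⟧ M) eq)
      go : ∀ f → toℕ f < toℕ e ⊎ toℕ f ≡ toℕ e → Best lab (toℕ e) (M 1 2) → crossing lab f ≡ true → w e ℚ.≤ w f
      go f (inj₂ f≡e) _ _ = ℚ.≤-reflexive (cong w (sym (toℕ-injective f≡e)))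
      go f (inj₁ f<e) (none _ no-cross) cross with () ← trans (sym cross) (no-cross f f<e)
      go f (inj₁ f<e) (some e₀ eq _ minimal) cross = ℚ.≤-trans
        (excess-nonZero (Core.base core) chosen e₀ counter e (cong (_∸ 1) eq) at-counter excess≢0)
        (minimal f f<e cross)
        where
        -- Once an edge has been found, 1 ⊖ best is 0, so only the excess can make the sum nonzero.
        excess≢0 : ⟦ excess chosen counter ⟧ M ≢ 0
        excess≢0 z = neq (trans (cong (ends-differ M *_) (cong₂ _+_ (trans (cong (1 ∸_) eq) (0∸n≡0 (toℕ e₀))) z))
                                (*-zeroʳ (ends-differ M)))

    not-improved : ∀ {lab x M} {e : Fin m} → Scan lab x (toℕ e) M → ⟦ improves ⟧ M ≡ 0 →
                   Best lab (suc (toℕ e)) (M 1 2)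
    not-improved {lab} {x} {M} {e} scan eq₀
      with m*n≡0⇒m≡0∨n≡0 (ends-differ M) eq₀ | Scan.found scan
    ... | inj₁ z | found = best-suc found (differ-zero (Scan.core scan) counter e (Scan.at-counter scan) z)
    -- With no edge found, 1 ⊖ best is 1 and the second factor cannot vanish.
    ... | inj₂ z | none eq _ with () ← trans (sym (m+n≡0⇒m≡0 (1 ∸ M 1 2) z)) (cong (1 ∸_) eq)
    ... | inj₂ z | some e₀ eq cross₀ minimal = some e₀ eq cross₀ λ f f< → go f (<suc-cases f<)
      where
      go : ∀ f → toℕ f < toℕ e ⊎ toℕ f ≡ toℕ e → crossing lab f ≡ true → w e₀ ℚ.≤ w f
      go f (inj₁ f<e) cross = minimal f f<e cross
      go f (inj₂ f≡e) _ = ℚ.≤-trans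
        (excess-zero (Core.base (Scan.core scan)) chosen e₀ counter e (cong (_∸ 1) eq) (Scan.at-counter scan)
          (m+n≡0⇒n≡0 (1 ∸ M 1 2) z))
        (ℚ.≤-reflexive (cong w (sym (toℕ-injective f≡e))))

    -- Hands on the exact memory instead of an abstract postcondition, so that later reads reduce by
    -- computation.
    halts-assign-seq : ∀ {M a e f Q} {Post : Memory → Set} → Bounded M → bits (⟦ f ⟧ M) ≤ s →
                       (Bounded (update M a (⟦ e ⟧ M) (⟦ f ⟧ M)) → Halts Q (update M a (⟦ e ⟧ M) (⟦ f ⟧ M)) Post) →
                       Halts (a ! e := f ⨾ Q) M Post
    halts-assign-seq {M} {a} {e} {f} bd v≤ rest =
      halts-seq {Mid = λ M′ → M′ ≡ update M a (⟦ e ⟧ M) (⟦ f ⟧ M)} (halts-assign bd v≤ refl) λ { bd′ refl → rest bd′ }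

    by-index : ∀ {N} (P : ℕ → Set) → (∀ (e : Fin N) → P (toℕ e)) → ∀ {i} → i < N → P i
    by-index P h i<N = subst P (toℕ-fromℕ< i<N) (h (fromℕ< i<N))

    +1≡suc : ∀ {z i} → z ≡ i → z + 1 ≡ suc i
    +1≡suc {z} eq = trans (+-comm z 1) (cong suc eq)

    scan-step : ∀ {lab x M} (e : Fin m) → Bounded M → Scan lab x (toℕ e) M →
                Halts scan-body M (Scan lab x (suc (toℕ e)))
    scan-step {lab} {x} {M} e bd scan = halts-seq {Mid = Mid}
      (halts-if bd
        (λ neq → halts-assign bd (suc-bits m-bits (toℕ<n e) at-counter)
          (core-scalar 0 _ core , at-counter ,
           subst (Best lab (suc (toℕ e))) (sym (+1≡suc at-counter)) (improved scan neq)))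
        (λ eq → halts-skip bd (core , at-counter , not-improved scan eq)))
      λ { bd′ (core′ , at′ , found′) → halts-assign bd′ (suc-bits m-bits (toℕ<n e) at′)
            (record { core = core-scalar 1 _ core′ ; at-counter = +1≡suc at′ ; found = found′ }) }
      where
      open Scan scan
      Mid : Memory → Set
      Mid M′ = Core lab x M′ × M′ 1 3 ≡ toℕ e × Best lab (suc (toℕ e)) (M′ 1 2)

    Searched : Labels → Solution I → Memory → Set
    Searched lab x M = Core lab x M × Best lab m (M 1 2)

    search-halts : ∀ {lab x M} → Bounded M → Core lab x M → Halts search M (Searched lab x)
    search-halts {lab} {x} {M} bd core =
      halts-assign-seq bd 1≤s λ bd₁ →
      halts-assign-seq bd₁ 1≤s λ bd₂ →
      halts-map (λ scan → Scan.core scan , Scan.found scan) (halts-for m (Scan lab x)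
        (λ scan → cong₂ _∸_ (Core.size-m (Scan.core scan)) (Scan.at-counter scan))
        (λ bd i<m → by-index (λ i → Scan lab x i _ → Halts scan-body _ (Scan lab x (suc i)))
                   (λ e → scan-step e bd) i<m)
        m≤s bd₂
        (record { core = core-scalar 1 _ (core-scalar 0 _ core) ; at-counter = refl ; found = none refl λ _ () }))

    -- Relabelling is in place, so the array is part new, part old. `best≢0` is carried along
    -- because cell 2 is also the test of the outer loop.
    record Relabel (lab : Labels) (x : Solution I) (a b : Fin n) (i : ℕ) (M : Memory) : Set where
      field
        base    : Base M
        copies  : ∀ e → M 0 (toℕ e) ≡ x e
        at-keep : M 1 4 ≡ toℕ a
        at-drop : M 1 5 ≡ toℕ b
        best≢0  : M 1 2 ≢ 0
        done    : ∀ d → toℕ d < i → M 2 (toℕ d) ≡ toℕ (merge lab a b d)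
        todo    : ∀ d → i ≤ toℕ d → M 2 (toℕ d) ≡ toℕ (lab d)
      open Base base public

    relabel-step : ∀ {lab x a b M} (d : Fin n) → Bounded M → Relabel lab x a b (toℕ d) M → M 1 3 ≡ toℕ d →
                   Halts relabel-body M (λ M′ → Relabel lab x a b (suc (toℕ d)) M′ × M′ 1 3 ≡ suc (toℕ d))
    relabel-step {lab} {x} {a} {b} {M} d bd rel at-d = halts-seq {Mid = Mid}
      (halts-if bd
        (λ neq → halts-skip bd (record
          { base = base ; copies = copies ; at-keep = at-keep ; at-drop = at-drop ; best≢0 = best≢0
          ; done = λ f f< → unchanged neq f (<suc-cases f<) ; todo = λ f d<f → todo f (<⇒≤ d<f) } , at-d))
        (λ eq → halts-assign bd (cell bd 1 4) (record
          { base = record { size-n = size-n ; size-m = size-m ; frozen = frozen }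
          ; copies = copies ; at-keep = at-keep ; at-drop = at-drop ; best≢0 = best≢0
          ; done = λ f f< → changed eq f (<suc-cases f<)
          ; todo = λ f d<f → trans (update-other M 2 (M 1 4) λ eq′ → <⇒≢ d<f (trans (sym at-d) eq′))
                                   (todo f (<⇒≤ d<f)) } , at-d)))
      λ { bd′ (rel′ , at′) → halts-assign bd′ (suc-bits n-bits (toℕ<n d) at′) (step rel′ , +1≡suc at′) }
      where
      open Relabel rel
      Mid : Memory → Set
      Mid M′ = Relabel lab x a b (suc (toℕ d)) M′ × M′ 1 3 ≡ toℕ d
      step : ∀ {i M z} → Relabel lab x a b i M → Relabel lab x a b i (update M 1 3 z)
      step rel = record { base = base-scalar 1 _ (R.base) ; copies = R.copies ; at-keep = R.at-keep
                        ; at-drop = R.at-drop ; best≢0 = R.best≢0 ; done = R.done ; todo = R.todo }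
        where module R = Relabel rel
      at-label : M 2 (M 1 3) ≡ toℕ (lab d)
      at-label = trans (cong (M 2) at-d) (todo d ≤-refl)
      unchanged : distance (M 2 (M 1 3)) (M 1 5) ≢ 0 → ∀ f → toℕ f < toℕ d ⊎ toℕ f ≡ toℕ d →
                  M 2 (toℕ f) ≡ toℕ (merge lab a b f)
      unchanged neq f (inj₁ f<d) = done f f<d
      unchanged neq f (inj₂ f≡d) with refl ← toℕ-injective f≡d =
        trans (todo d ≤-refl) (cong (λ t → toℕ (if t then a else lab d)) (sym (dec-false (lab d Fin.≟ b) λ eq →
          neq (trans (cong₂ distance (trans at-label (cong toℕ eq)) at-drop) (distance-refl (toℕ b))))))
      changed : distance (M 2 (M 1 3)) (M 1 5) ≡ 0 → ∀ f → toℕ f < toℕ d ⊎ toℕ f ≡ toℕ d →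
                update M 2 (M 1 3) (M 1 4) 2 (toℕ f) ≡ toℕ (merge lab a b f)
      changed eq f (inj₁ f<d) = trans (update-other M 2 (M 1 4) λ eq′ → <⇒≢ f<d (trans (sym eq′) at-d)) (done f f<d)
      changed eq f (inj₂ f≡d) with refl ← toℕ-injective f≡d = begin
        update M 2 (M 1 3) (M 1 4) 2 (toℕ d)   ≡⟨ cong (update M 2 (M 1 3) (M 1 4) 2) at-d ⟨
        update M 2 (M 1 3) (M 1 4) 2 (M 1 3)   ≡⟨ update-same M 2 (M 1 3) (M 1 4) ⟩
        M 1 4                                  ≡⟨ at-keep ⟩
        toℕ a
          ≡⟨ cong (λ t → toℕ (if t then a else lab d)) (dec-true (lab d Fin.≟ b) lab≡b) ⟨
        toℕ (merge lab a b d)                  ∎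
        where
        open ≡-Reasoning
        lab≡b : lab d ≡ b
        lab≡b = toℕ-injective (trans (sym at-label) (trans (distance-zero eq) at-drop))

    -- A requirement is one of the q i and so already stands in an input cell; hence the output
    -- array obeys the cell bound.
    req-bits : ∀ e → bits (req e) ≤ s
    req-bits e with req-attained e
    ... | i , _ , eq = subst (λ z → bits z ≤ s) (trans (at-q i) (sym eq)) (cell M₀-bounded 3 (toℕ i))

    Joined : Labels → Solution I → Fin m → Memory → Set
    Joined lab x e₀ M = ∃[ x′ ] Core (merge lab (lab (u e₀)) (lab (v e₀))) x′ M ×
                                x′ e₀ ≡ req e₀ × (∀ e → e ≢ e₀ → x′ e ≡ x e) × M 1 2 ≢ 0

    join-halts : ∀ {lab x M} e₀ → Bounded M → Core lab x M → M 1 2 ≡ suc (toℕ e₀) → Halts join M (Joined lab x e₀)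
    join-halts {lab} {x} {M} e₀ bd core at-best =
      halts-assign-seq bd (subst (λ z → bits z ≤ s) (sym at-req) (req-bits e₀)) λ bd₁ →
      halts-assign-seq bd₁ (cell bd₁ 2 _) λ bd₂ →
      halts-assign-seq bd₂ (cell bd₂ 2 _) λ bd₃ →
      halts-assign-seq bd₃ 1≤s λ bd₄ →
      halts-map joined (halts-for n (λ i M → Relabel lab x′ a b i M × M 1 3 ≡ i)
        (λ { (rel , at) → cong₂ _∸_ (Relabel.size-n rel) at })
        (λ { {i} {M} bd i<n (rel , at) → by-index
               (λ i → Relabel lab x′ a b i M → M 1 3 ≡ i →
                    Halts relabel-body M (λ M′ → Relabel lab x′ a b (suc i) M′ × M′ 1 3 ≡ suc i))
               (λ d → relabel-step d bd) i<n rel at })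
        (<⇒≤ n<s) bd₄
        (record { base = Core.base core₄ ; copies = Core.chosen-copies core₄
                ; at-keep = read-label-u core₁ chosen e₀ at-chosen
                ; at-drop = read-label-v core₂ chosen e₀ at-chosen
                ; best≢0 = λ eq → contradiction (trans (sym at-best) eq) λ ()
                ; done = λ _ () ; todo = λ d _ → Core.labels core₄ d } , refl))
      where
      a b : Fin n
      a = lab (u e₀)
      b = lab (v e₀)
      at-chosen : M 1 2 ∸ 1 ≡ toℕ e₀
      at-chosen = cong (_∸ 1) at-best
      at-req : ⟦ reqExp chosen ⟧ M ≡ req e₀
      at-req = read-req (Core.base core) chosen e₀ at-chosen
      M₁ M₂ M₃ M₄ : Memory
      M₁ = update M 0 (⟦ chosen ⟧ M) (⟦ reqExp chosen ⟧ M)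
      M₂ = update M₁ 1 4 (⟦ 2 ! (4 ! chosen) ⟧ M₁)
      M₃ = update M₂ 1 5 (⟦ 2 ! (5 ! chosen) ⟧ M₂)
      M₄ = update M₃ 1 3 0
      x′ : Solution I
      -- The new solution is read off the memory, which makes its agreement with array 0
      -- definitional.
      x′ e = M₁ 0 (toℕ e)
      core₁ : Core lab x′ M₁
      core₁ = record { base = record { size-n = size-n ; size-m = size-m ; frozen = frozen }
                     ; labels = labels ; chosen-copies = λ _ → refl }
        where open Core core
      core₂ : Core lab x′ M₂
      core₂ = core-scalar 2 _ core₁
      core₄ : Core lab x′ M₄
      core₄ = core-scalar 1 _ (core-scalar 3 _ core₂)
      x′-chosen : x′ e₀ ≡ req e₀
      x′-chosen = trans (cong (M₁ 0) (sym at-chosen))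
        (trans (update-same M 0 (⟦ chosen ⟧ M) (⟦ reqExp chosen ⟧ M)) at-req)
      x′-other : ∀ e → e ≢ e₀ → x′ e ≡ x e
      x′-other e e≢e₀ = trans
        (update-other M 0 (⟦ reqExp chosen ⟧ M) λ eq → e≢e₀ (toℕ-injective (trans (sym eq) at-chosen)))
                              (Core.chosen-copies core e)
      joined : ∀ {M} → Relabel lab x′ a b n M × M 1 3 ≡ n → Joined lab x e₀ M
      joined (rel , _) = x′ ,
        record { base = Relabel.base rel ; labels = λ d → Relabel.done rel d (toℕ<n d)
             ; chosen-copies = Relabel.copies rel } ,
        x′-chosen , x′-other , Relabel.best≢0 rel

    -- Each join lowers the number of components, which serves as the variant. At j = 0 the second
    -- case is impossible, so the search must have come up empty.
    Status : Labels → ℕ → Memory → Set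
    Status lab j M = (M 1 2 ≡ 0 × (∀ e → crossing lab e ≡ false)) ⊎ (M 1 2 ≢ 0 × components lab < j)

    -- j bounds the number of further rounds.
    record Loop (j : ℕ) (M : Memory) : Set where
      field
        lab    : Labels
        x      : Solution I
        core   : Core lab x M
        forest : Forest lab x
        status : Status lab j M

    round-halts : ∀ {j M} → Bounded M → Loop (suc j) M → M 1 2 ≢ 0 → Halts round M (Loop j)
    round-halts {j} {M} bd loop neq = go (Loop.status loop)
      where
      open Loop loop using (lab; x; core; forest)
      go : Status lab (suc j) M → Halts round M (Loop j)
      go (inj₁ (eq , _)) = contradiction eq neq
      go (inj₂ (_ , s≤s κ≤j)) = halts-seq (search-halts bd core) λ { bd′ (core′ , found) →
        halts-if bd′ (then-case bd′ core′ found) (else-case bd′ core′ found) }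
        where
        after-join : ∀ {M} e₀ → crossing lab e₀ ≡ true →
                     (∀ e → toℕ e < m → crossing lab e ≡ true → w e₀ ℚ.≤ w e) → Joined lab x e₀ M → Loop j M
        after-join e₀ cross₀ minimal (x′ , core′ , x′₀ , x′≡x , best≢0) = record
          { core   = core′
          ; forest = forest-step cross₀ (λ e → minimal e (toℕ<n e)) x′₀ x′≡x forest
          ; status = inj₂ (best≢0 , ≤-trans (merge-components (Forest.rooted forest) cross₀) κ≤j) }
        then-case : ∀ {M} → Bounded M → Core lab x M → Best lab m (M 1 2) → M 1 2 ≢ 0 → Halts join M (Loop j)
        then-case bd core (none eq _) neq = contradiction eq neq
        then-case bd core (some e₀ eq cross₀ minimal) neq =
          halts-map (after-join e₀ cross₀ minimal) (join-halts e₀ bd core eq)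
        else-case : ∀ {M} → Bounded M → Core lab x M → Best lab m (M 1 2) → M 1 2 ≡ 0 → Halts skip M (Loop j)
        else-case bd core (none eq no-cross) _ = halts-skip bd (record
          { core = core ; forest = forest ; status = inj₁ (eq , λ e → no-cross e (toℕ<n e)) })
        else-case bd core (some _ eq _ _) eq₀ = contradiction (trans (sym eq₀) eq) λ ()

    Correct : Memory → Set
    Correct M = FeasibleInstance I → Approximate I (ℤ.+ 2 ℚ./ 1) (output I M)

    main-halts : Halts main M₀ Correct
    main-halts = halts-if M₀-bounded branch (λ eq →
      halts-skip M₀-bounded λ _ → zero-approximates (trans (sym (at-q zero)) eq) λ e → zeros (toℕ e))
      where
      loop₀ : Loop (suc n) (update M₀ 1 2 1)
      loop₀ = record
        { core   = core-scalar 0 1 (record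
            { base = record { size-n = at-n ; size-m = at-m ; frozen = λ _ _ → refl }
            ; labels = at-vertex ; chosen-copies = λ _ → refl })
        ; forest = forest-init λ e → zeros (toℕ e)
        -- At most n components at the start, and the strict bound asks for n + 1 rounds.
        ; status = inj₂ ((λ ()) , s≤s (∑ℕ-≤ (λ a → if live (λ a → a) a then 1 else 0) λ a → 𝔹≤1 (live (λ a → a) a)))
        }
        where
        𝔹≤1 : ∀ t → (if t then 1 else 0) ≤ 1
        𝔹≤1 true  = ≤-refl
        𝔹≤1 false = z≤n
      finish : 1 ≤ q zero → ∀ {M} → M 1 2 ≡ 0 × (∃[ j ] Loop j M) → Correct M
      finish 1≤q₀ {M} (eq , j , loop) feasible = go (Loop.status loop)
        where
        go : Status (Loop.lab loop) j M → Approximate I (ℤ.+ 2 ℚ./ 1) (output I M)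
        go (inj₁ (_ , no-cross)) = forest-approximates 1≤q₀
          (forest-resp (λ e → sym (Core.chosen-copies (Loop.core loop) e)) (Loop.forest loop)) no-cross feasible
        go (inj₂ (neq , _)) = contradiction eq neq
      last : ∀ {M} → Loop 0 M → M 1 2 ≡ 0
      last loop with Loop.status loop
      ... | inj₁ (eq , _) = eq
      branch : M₀ 3 0 ≢ 0 → Halts (1 ! lit 2 := lit 1 ⨾ while best run round) M₀ Correct
      branch neq = halts-assign-seq M₀-bounded 1≤s λ bd →
        halts-map (finish (n≢0⇒n>0 (λ eq → neq (trans (at-q zero) eq))))
        (halts-while Loop last round-halts n<s bd loop₀)

  1≤inputSize : ∀ {k} (I : Instance k) → 1 ≤ inputSize (encode I)
  1≤inputSize I = s≤s z≤n

  polyTime : ∀ {k} α P → Polynomial (budget P) →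
             (∀ (I : Instance k) → Timed.Halts (inputSize (encode I)) (1≤inputSize I) P (load (encode I))
                λ M → FeasibleInstance I → Approximate I α (output I M)) →
             PolyTimeApproximation k α
  polyTime {k} α P (a , d , budget≤) halts = P , a , d , λ I → timely I (halts I)
    where
    timely : ∀ I → Timed.Halts (inputSize (encode I)) (1≤inputSize I) P (load (encode I))
                     (λ M → FeasibleInstance I → Approximate I α (output I M)) →
             ∃[ t ] ∃[ M ] Run P (load (encode I)) t M × t ≤ a * inputSize (encode I) ^ d
               × (FeasibleInstance I → Approximate I α (output I M))
    timely I (t , M , r , t≤ , _ , correct) =
      t , M , r , ≤-trans t≤ (budget≤ (inputSize (encode I)) (1≤inputSize I)) , correct

open import Data.Nat.Base using (ℕ; suc; _≤_)
open import Data.Nat.Properties using (≤-refl)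
open import Data.Integer.Base using (+_)
open import Data.Rational.Base using (_/_)
open LogarithmicCost using (budget-polynomial; module Timed)
open Algorithm

theorem1p3 : (k : ℕ) → 1 ≤ k → PolyTimeApproximation k (+ 2 / 1)
theorem1p3 (suc k) _ = polyTime (+ 2 / 1) (Code.main (suc k)) (budget-polynomial (Code.main (suc k))) λ I →
  Verification.main-halts I (inputSize (encode I)) (1≤inputSize I) (n<inputSize I) (m≤inputSize I)
    (load (encode I)) (Timed.bounded λ a i → load-bits (encode I) a i (1≤inputSize I) ≤-refl) (load-encodes I)
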